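{- Let $\mathrm{cost}_k(n)=n^{\alpha_k}$, where $\alpha_k\in[0,k]$. Let $\mathcal A$ be a randomised $\mathtt{cIND}$-oracle algorithm with worst-case expected oracle cost at most $C$ such that, for all $n$-vertex $k$-hypergraphs $G$, with probability at least $9/10$, $\mathcal A(\mathtt{cIND}(G))$ returns $1$ if and only if $e(G)>0$. Then $C\ge n^{\alpha_k}/100$.
   Context: A $k$-hypergraph is a $k$-uniform hypergraph; $n$-vertex hypergraphs have vertex set $[n]$ (with $n\ge k$); $e(G)$ is the number of edges. $\mathtt{cIND}(G)$ is the bitstring indexed by $k$-tuples of pairwise disjoint $S_1,\dots,S_k\subseteq[n]$, with $\mathtt{cIND}(G)_{S_1,\dots,S_k}=1$ if $G$ contains no edge $e$ with $|S_i\cap e|=1$ for all $i$, and $0$ otherwise. A $\mathtt{cIND}$-oracle algorithm receives $n$ and $k$ explicitly and accesses $G$ only via adaptive queries to bits of $\mathtt{cIND}(G)$; a randomised oracle algorithm is a discrete probability distribution over deterministic ones. A query $(S_1,\dots,S_k)$ costs $\mathrm{cost}_k(|S_1|+\dots+|S_k|)$ (with $\mathrm{cost}_k(0):=0$); the oracle cost on $G$ is the sum of query costs; the worst-case expected oracle cost is the maximum over all $n$-vertex $k$-hypergraphs $G$ of the expected oracle cost on $G$. -}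

module Defs where

open import Data.Bool.Base using (Bool; not; if_then_else_)
open import Data.Fin.Subset using (Subset; Empty; _∩_; ∣_∣)
open import Data.Integer.Base as ℤ using (ℤ; +_; -[1+_]; +≤+)
import Data.Integer.Properties as ℤ
import Data.Integer.Solver as ℤSolver
open import Data.List.Base using (List; length)
open import Data.List.Relation.Unary.All using (All)
open import Data.List.Relation.Unary.Any using (any?)
open import Data.List.Relation.Unary.Unique.Propositional using (Unique)
open import Data.Nat.Base as ℕ using (ℕ; zero; suc; _⊔_; z≤n; s≤s)
import Data.Nat.Properties as ℕ
import Data.Nat.Solver as ℕSolver
open import Data.Product.Base using (∃-syntax; _×_; _,_; proj₁; proj₂)
open import Data.Rational.Base as ℚ using (ℚ; 0ℚ; 1ℚ; ½; *≤*; *<*)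
import Data.Rational.Properties as ℚ
import Data.Rational.Solver as ℚSolver
import Data.Rational.Unnormalised.Base as ℚᵘ
import Data.Rational.Unnormalised.Properties as ℚᵘ
open import Data.Sum.Base using (inj₁; inj₂)
open import Data.Vec.Base as Vec using (Vec)
import Data.Vec.Relation.Unary.All as VAll
open import Data.Vec.Relation.Unary.AllPairs using (AllPairs)
open import Function.Base using (_$_; it)
open import Function.Bundles using (_⇔_; mk⇔; Equivalence)
open import Level using (0ℓ)
open import Relation.Binary.PropositionalEquality
open import Relation.Nullary using (contradiction; Dec; does; yes; no)
open import Relation.Nullary.Decidable as Dec using (_→-dec_; _×-dec_)
open import Relation.Unary using (Pred; Decidable)

------------------------------------------------------------------------
-- Cauchy sequences of rationals, with a modulus of convergence. Equality of
-- the represented reals is x ≤ᴿ y × y ≤ᴿ x, not propositional equality.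

record ℝ : Set where
  constructor mkℝ
  field
    seq    : ℕ → ℚ
    cauchy : ∀ ε → 0ℚ ℚ.< ε →
             ∃[ N ] ∀ i j → N ℕ.≤ i → N ℕ.≤ j → ℚ.∣ seq i ℚ.- seq j ∣ ℚ.≤ ε

open ℝ public

infix 4 _≤ᴿ_

_≤ᴿ_ : ℝ → ℝ → Set
x ≤ᴿ y = ∀ ε → 0ℚ ℚ.< ε → ∃[ N ] ∀ i → N ℕ.≤ i → seq x i ℚ.≤ seq y i ℚ.+ ε

fromℚ : ℚ → ℝ
fromℚ q = mkℝ (λ _ → q) λ ε 0<ε →
  0 , λ _ _ _ _ → subst (λ r → ℚ.∣ r ∣ ℚ.≤ ε) (sym (ℚ.+-inverseʳ q)) (ℚ.<⇒≤ 0<ε)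

fromℕ : ℕ → ℝ
fromℕ n = fromℚ (+ n ℚ./ 1)

0ᴿ 1ᴿ : ℝ
0ᴿ = fromℚ 0ℚ
1ᴿ = fromℚ 1ℚ

module RationalLemmas where
  half>0 : ∀ {ε} → 0ℚ ℚ.< ε → 0ℚ ℚ.< ½ ℚ.* ε
  half>0 {ε} 0<ε = subst (ℚ._< ½ ℚ.* ε) (ℚ.*-zeroʳ ½) (ℚ.*-monoʳ-<-pos ½ 0<ε)

  half+half : ∀ ε → ½ ℚ.* ε ℚ.+ ½ ℚ.* ε ≡ ε
  half+half ε = trans (sym (ℚ.*-distribʳ-+ ε ½ ½)) (ℚ.*-identityˡ ε)

  m≤⊔ : ∀ {i} a b → a ⊔ b ℕ.≤ i → a ℕ.≤ i
  m≤⊔ a b = ℕ.≤-trans (ℕ.m≤m⊔n a b)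

  n≤⊔ : ∀ {i} a b → a ⊔ b ℕ.≤ i → b ℕ.≤ i
  n≤⊔ a b = ℕ.≤-trans (ℕ.m≤n⊔m a b)

  p≤∣p∣ : ∀ p → p ℚ.≤ ℚ.∣ p ∣
  p≤∣p∣ p with ℚ.≤-total 0ℚ p
  ... | inj₁ 0≤p = ℚ.≤-reflexive (sym (ℚ.0≤p⇒∣p∣≡p 0≤p))
  ... | inj₂ p≤0 = ℚ.≤-trans p≤0 (ℚ.0≤∣p∣ p)

  p-q≤r⇒p≤q+r : ∀ {p q r} → p ℚ.- q ℚ.≤ r → p ℚ.≤ q ℚ.+ r
  p-q≤r⇒p≤q+r {p} {q} {r} h = subst (ℚ._≤ q ℚ.+ r)
      (solve 2 (λ p q → q :+ (p :- q) := p) refl p q) (ℚ.+-monoʳ-≤ q h)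
    where open ℚSolver.+-*-Solver

  p≤q+r⇒p-q≤r : ∀ {p q r} → p ℚ.≤ q ℚ.+ r → p ℚ.- q ℚ.≤ r
  p≤q+r⇒p-q≤r {p} {q} {r} h = subst (p ℚ.- q ℚ.≤_)
      (solve 2 (λ q r → (q :+ r) :- q := r) refl q r) (ℚ.+-monoˡ-≤ (ℚ.- q) h)
    where open ℚSolver.+-*-Solver

  ∣p-q∣≤ : ∀ {p q r} → p ℚ.≤ q ℚ.+ r → q ℚ.≤ p ℚ.+ r → ℚ.∣ p ℚ.- q ∣ ℚ.≤ r
  ∣p-q∣≤ {p} {q} {r} h₁ h₂ with ℚ.∣p∣≡p∨∣p∣≡-p (p ℚ.- q)
  ... | inj₁ e = subst (ℚ._≤ r) (sym e) (p≤q+r⇒p-q≤r h₁)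
  ... | inj₂ e = subst (ℚ._≤ r)
      (trans (solve 2 (λ p q → q :- p := :- (p :- q)) refl p q) (sym e)) (p≤q+r⇒p-q≤r h₂)
    where open ℚSolver.+-*-Solver

  1/1+_ : ℕ → ℚ
  1/1+ d = + 1 ℚ./ suc d

  ι : ℕ → ℚ
  ι n = + n ℚ./ 1

  /-mono : ∀ a b c d → a ℕ.* suc d ℕ.≤ c ℕ.* suc b → + a ℚ./ suc b ℚ.≤ + c ℚ./ suc d
  /-mono a b c d h = ℚ.toℚᵘ-cancel-≤ $
    ℚᵘ.≤-trans (ℚᵘ.≤-reflexive (ℚ.toℚᵘ-fromℚᵘ (ℚᵘ.mkℚᵘ (+ a) b))) $
    ℚᵘ.≤-trans (ℚᵘ.*≤* (subst₂ ℤ._≤_ (ℤ.pos-* a (suc d)) (ℤ.pos-* c (suc b)) (+≤+ h)))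
               (ℚᵘ.≤-reflexive (ℚᵘ.≃-sym (ℚ.toℚᵘ-fromℚᵘ (ℚᵘ.mkℚᵘ (+ c) d))))

  /-eq : ∀ a b c d → a ℕ.* suc d ≡ c ℕ.* suc b → + a ℚ./ suc b ≡ + c ℚ./ suc d
  /-eq a b c d h = ℚ.≤-antisym (/-mono a b c d (ℕ.≤-reflexive h))
                               (/-mono c d a b (ℕ.≤-reflexive (sym h)))

  /-* : ∀ a b c d → (+ a ℚ./ suc b) ℚ.* (+ c ℚ./ suc d) ≡ + (a ℕ.* c) ℚ./ (suc b ℕ.* suc d)
  /-* a b c d = ℚ.toℚᵘ-injective $
    ℚᵘ.≃-trans (ℚ.toℚᵘ-homo-* (+ a ℚ./ suc b) (+ c ℚ./ suc d)) $
    ℚᵘ.≃-trans (ℚᵘ.*-cong (ℚ.toℚᵘ-fromℚᵘ (ℚᵘ.mkℚᵘ (+ a) b)) (ℚ.toℚᵘ-fromℚᵘ (ℚᵘ.mkℚᵘ (+ c) d))) $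
    ℚᵘ.≃-trans (ℚᵘ.≃-reflexive (cong (λ z → ℚᵘ.mkℚᵘ z _) (sym (ℤ.pos-* a c)))) $
    ℚᵘ.≃-sym (ℚ.toℚᵘ-fromℚᵘ (ℚᵘ.mkℚᵘ (+ (a ℕ.* c)) (d ℕ.+ b ℕ.* suc d)))

  frac≡ : ∀ a d → + a ℚ./ suc d ≡ ι a ℚ.* 1/1+ d
  frac≡ a d = sym (trans (/-* a 0 1 d)
    (/-eq (a ℕ.* 1) (d ℕ.+ 0) a d (solve 2 (λ a d → a :* con 1 :* (con 1 :+ d) :=
                                            a :* (con 1 :+ (d :+ con 0))) refl a d)))
    where open ℕSolver.+-*-Solver

  ι-inv : ∀ d → ι (suc d) ℚ.* 1/1+ d ≡ 1ℚ
  ι-inv d = trans (sym (frac≡ (suc d) d)) (/-eq (suc d) d 1 0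
    (trans (ℕ.*-identityʳ (suc d)) (sym (ℕ.*-identityˡ (suc d)))))

  ι-* : ∀ a b → ι (a ℕ.* b) ≡ ι a ℚ.* ι b
  ι-* a b = sym (/-* a 0 b 0)

  ι-+ : ∀ a b → ι (a ℕ.+ b) ≡ ι a ℚ.+ ι b
  ι-+ a b = ℚ.toℚᵘ-injective $
    ℚᵘ.≃-trans (ℚ.toℚᵘ-fromℚᵘ (ℚᵘ.mkℚᵘ (+ (a ℕ.+ b)) 0)) $
    ℚᵘ.≃-trans (ℚᵘ.*≡* (cong (ℤ._* + 1) (sym (trans
      (cong₂ ℤ._+_ (ℤ.*-identityʳ (+ a)) (ℤ.*-identityʳ (+ b))) refl)))) $
    ℚᵘ.≃-trans (ℚᵘ.≃-sym (ℚᵘ.+-cong (ℚ.toℚᵘ-fromℚᵘ (ℚᵘ.mkℚᵘ (+ a) 0))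
                                    (ℚ.toℚᵘ-fromℚᵘ (ℚᵘ.mkℚᵘ (+ b) 0)))) $
    ℚᵘ.≃-sym (ℚ.toℚᵘ-homo-+ (ι a) (ι b))

  ι-mono : ∀ {a b} → a ℕ.≤ b → ι a ℚ.≤ ι b
  ι-mono {a} {b} h = /-mono a 0 b 0 (ℕ.*-monoˡ-≤ 1 h)

  1/1+-anti : ∀ {a b} → a ℕ.≤ b → 1/1+ b ℚ.≤ 1/1+ a
  1/1+-anti {a} {b} h = /-mono 1 b 1 a (ℕ.*-monoʳ-≤ 1 (s≤s h))

  1/1+>0 : ∀ d → 0ℚ ℚ.< 1/1+ d
  1/1+>0 d = ℚ.positive⁻¹ (1/1+ d) {{ℚ.normalize-pos 1 (suc d)}}

  ι≥0 : ∀ n → 0ℚ ℚ.≤ ι n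
  ι≥0 n = ι-mono {0} {n} z≤n

  mul-mono : ∀ {p q r s} → 0ℚ ℚ.≤ p → 0ℚ ℚ.≤ s → p ℚ.≤ q → r ℚ.≤ s → p ℚ.* r ℚ.≤ q ℚ.* s
  mul-mono {p} {q} {r} {s} 0≤p 0≤s pq rs = ℚ.≤-trans
    (ℚ.*-monoˡ-≤-nonNeg p {{ℚ.nonNegative 0≤p}} rs)
    (ℚ.*-monoʳ-≤-nonNeg s {{ℚ.nonNegative 0≤s}} pq)

  ceil : ∀ q → ∃[ n ] q ℚ.≤ ι n
  ceil q@(ℚ.mkℚ z d c) = ℤ.∣ z ∣ , subst (ℚ._≤ ι ℤ.∣ z ∣) (ℚ.↥p/↧p≡p q) (go z)
    where
    go : ∀ z → z ℚ./ suc d ℚ.≤ ι ℤ.∣ z ∣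
    go (+ n)    = /-mono n d n 0 (ℕ.*-monoʳ-≤ n (s≤s z≤n))
    go -[1+ n ] = ℚ.≤-trans
      (ℚ.neg-antimono-≤ (ℚ.<⇒≤ (ℚ.positive⁻¹ (+ suc n ℚ./ suc d) {{ℚ.normalize-pos (suc n) (suc d)}})))
      (ι≥0 (suc n))

  arch₁ : ∀ ε → 0ℚ ℚ.< ε → ∃[ d ] 1/1+ d ℚ.≤ ε
  arch₁ ε@(ℚ.mkℚ (+ suc n) d c) _ = d , subst (1/1+ d ℚ.≤_) (ℚ.↥p/↧p≡p ε)
    (/-mono 1 d (suc n) d (ℕ.*-monoˡ-≤ (suc d) {1} {suc n} (s≤s z≤n)))
  arch₁ (ℚ.mkℚ (+ zero) d c) (*<* (ℤ.+<+ ()))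
  arch₁ (ℚ.mkℚ -[1+ n ] d c) (*<* ())

  arch : ∀ n ε → 0ℚ ℚ.< ε → ∃[ d ] ι n ℚ.* 1/1+ d ℚ.≤ ε
  arch n ε 0<ε with arch₁ ε 0<ε
  ... | e , h = e ℕ.+ n ℕ.* suc e , ℚ.≤-trans (subst (ℚ._≤ 1/1+ e) (frac≡ n _)
        (/-mono n (e ℕ.+ n ℕ.* suc e) 1 e
          (ℕ.≤-trans (ℕ.m≤n+m (n ℕ.* suc e) (suc e)) (ℕ.≤-reflexive (sym (ℕ.*-identityˡ _)))))) h

  bounded : ∀ x → ∃[ n ] ∃[ N ] ∀ i → N ℕ.≤ i → ℚ.∣ seq x i ∣ ℚ.≤ ι n
  bounded x with cauchy x 1ℚ (ℚ.positive⁻¹ 1ℚ)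
  ... | N , h with ceil (ℚ.∣ seq x N ∣ ℚ.+ 1ℚ)
  ... | n , le = n , N , λ i N≤i → ℚ.≤-trans
    (subst (λ r → ℚ.∣ r ∣ ℚ.≤ ℚ.∣ seq x N ∣ ℚ.+ 1ℚ)
      (solve 2 (λ a b → b :+ (a :- b) := a) refl (seq x i) (seq x N))
      (ℚ.≤-trans (ℚ.∣p+q∣≤∣p∣+∣q∣ (seq x N) (seq x i ℚ.- seq x N))
                 (ℚ.+-monoʳ-≤ ℚ.∣ seq x N ∣ (h i N N≤i ℕ.≤-refl)))) le
    where open ℚSolver.+-*-Solver

open RationalLemmas

infixl 6 _+ᴿ_
infixl 7 _*ᴿ_

_+ᴿ_ : ℝ → ℝ → ℝ
x +ᴿ y = mkℝ (λ i → seq x i ℚ.+ seq y i) pf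
  where
  open ℚSolver.+-*-Solver
  pf : ∀ ε → 0ℚ ℚ.< ε → ∃[ N ] ∀ i j → N ℕ.≤ i → N ℕ.≤ j →
       ℚ.∣ (seq x i ℚ.+ seq y i) ℚ.- (seq x j ℚ.+ seq y j) ∣ ℚ.≤ ε
  pf ε 0<ε with cauchy x _ (half>0 0<ε) | cauchy y _ (half>0 0<ε)
  ... | M , hx | N , hy = M ⊔ N , λ i j Ni Nj →
    subst₂ (λ p q → ℚ.∣ p ∣ ℚ.≤ q)
      (solve 4 (λ a b c d → (a :- c) :+ (b :- d) := (a :+ b) :- (c :+ d)) refl
        (seq x i) (seq y i) (seq x j) (seq y j))
      (half+half ε)
      (ℚ.≤-trans (ℚ.∣p+q∣≤∣p∣+∣q∣ (seq x i ℚ.- seq x j) (seq y i ℚ.- seq y j))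
        (ℚ.+-mono-≤ (hx i j (m≤⊔ M N Ni) (m≤⊔ M N Nj)) (hy i j (n≤⊔ M N Ni) (n≤⊔ M N Nj))))

module ProductLemmas where
  scaled : ∀ n ε → 0ℚ ℚ.< ε → ∃[ δ ] 0ℚ ℚ.< δ × ι n ℚ.* δ ℚ.≤ ε
  scaled n ε 0<ε = 1/1+ proj₁ (arch n ε 0<ε) , 1/1+>0 (proj₁ (arch n ε 0<ε)) , proj₂ (arch n ε 0<ε)

  mul-diff : ∀ a b c d → a ℚ.* (b ℚ.- d) ℚ.+ d ℚ.* (a ℚ.- c) ≡ a ℚ.* b ℚ.- c ℚ.* d
  mul-diff a b c d = begin
    a ℚ.* (b ℚ.- d) ℚ.+ d ℚ.* (a ℚ.- c)
      ≡⟨ cong₂ ℚ._+_ (ℚ.*-distribˡ-+ a b (ℚ.- d)) (ℚ.*-distribˡ-+ d a (ℚ.- c)) ⟩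
    (a ℚ.* b ℚ.+ a ℚ.* ℚ.- d) ℚ.+ (d ℚ.* a ℚ.+ d ℚ.* ℚ.- c)
      ≡⟨ cong₂ (λ s t → (a ℚ.* b ℚ.+ s) ℚ.+ t)
           (sym (ℚ.neg-distribʳ-* a d))
           (cong₂ ℚ._+_ (ℚ.*-comm d a) (trans (sym (ℚ.neg-distribʳ-* d c)) (cong ℚ.-_ (ℚ.*-comm d c)))) ⟩
    (a ℚ.* b ℚ.- a ℚ.* d) ℚ.+ (a ℚ.* d ℚ.- c ℚ.* d)
      ≡⟨ telescope (a ℚ.* b) (a ℚ.* d) (c ℚ.* d) ⟩
    a ℚ.* b ℚ.- c ℚ.* d ∎
    where
    open ≡-Reasoning
    open ℚSolver.+-*-Solver
    telescope : ∀ u v w → (u ℚ.- v) ℚ.+ (v ℚ.- w) ≡ u ℚ.- w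
    telescope = solve 3 (λ u v w → (u :- v) :+ (v :- w) := u :- w) refl

  mul-close : ∀ {a b c d A D δ γ ε} → 0ℚ ℚ.≤ δ → 0ℚ ℚ.≤ γ →
    ℚ.∣ a ∣ ℚ.≤ A → ℚ.∣ d ∣ ℚ.≤ D → ℚ.∣ b ℚ.- d ∣ ℚ.≤ δ → ℚ.∣ a ℚ.- c ∣ ℚ.≤ γ →
    A ℚ.* δ ℚ.≤ ½ ℚ.* ε → D ℚ.* γ ℚ.≤ ½ ℚ.* ε →
    ℚ.∣ a ℚ.* b ℚ.- c ℚ.* d ∣ ℚ.≤ ε
  mul-close {a} {b} {c} {d} {A} {D} {δ} {γ} {ε} 0≤δ 0≤γ hA hD hδ hγ h₁ h₂ =
    subst₂ (λ p q → ℚ.∣ p ∣ ℚ.≤ q) (mul-diff a b c d) (half+half ε)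
      (ℚ.≤-trans (ℚ.∣p+q∣≤∣p∣+∣q∣ (a ℚ.* (b ℚ.- d)) (d ℚ.* (a ℚ.- c)))
        (ℚ.+-mono-≤ (part a (b ℚ.- d) 0≤δ hA hδ h₁) (part d (a ℚ.- c) 0≤γ hD hγ h₂)))
    where
    part : ∀ u v {U V} → 0ℚ ℚ.≤ V → ℚ.∣ u ∣ ℚ.≤ U → ℚ.∣ v ∣ ℚ.≤ V → U ℚ.* V ℚ.≤ ½ ℚ.* ε →
           ℚ.∣ u ℚ.* v ∣ ℚ.≤ ½ ℚ.* ε
    part u v {U} {V} 0≤V hu hv h = subst (ℚ._≤ ½ ℚ.* ε) (sym (ℚ.∣p*q∣≡∣p∣*∣q∣ u v))
      (ℚ.≤-trans (mul-mono (ℚ.0≤∣p∣ u) 0≤V hu hv) h)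

open ProductLemmas

_*ᴿ_ : ℝ → ℝ → ℝ
x *ᴿ y = mkℝ (λ i → seq x i ℚ.* seq y i) pf
  where
  pf : ∀ ε → 0ℚ ℚ.< ε → ∃[ N ] ∀ i j → N ℕ.≤ i → N ℕ.≤ j →
       ℚ.∣ seq x i ℚ.* seq y i ℚ.- seq x j ℚ.* seq y j ∣ ℚ.≤ ε
  pf ε 0<ε =
    let a , A , hA = bounded x
        b , B , hB = bounded y
        δ , 0<δ , hδ = scaled a _ (half>0 0<ε)
        γ , 0<γ , hγ = scaled b _ (half>0 0<ε)
        M , hM = cauchy y δ 0<δ
        N , hN = cauchy x γ 0<γ
        K = A ⊔ B
        L = M ⊔ N
    in K ⊔ L , λ i j Ni Nj → mul-close (ℚ.<⇒≤ 0<δ) (ℚ.<⇒≤ 0<γ)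
         (hA i (m≤⊔ A B (m≤⊔ K L Ni))) (hB j (n≤⊔ A B (m≤⊔ K L Nj)))
         (hM i j (m≤⊔ M N (n≤⊔ K L Ni)) (m≤⊔ M N (n≤⊔ K L Nj)))
         (hN i j (n≤⊔ M N (n≤⊔ K L Ni)) (n≤⊔ M N (n≤⊔ K L Nj)))
         hδ hγ

------------------------------------------------------------------------
-- For positive m, the real m^α is the limit of ⌊(i+1)·m^(α_i)⌋/(i+1), where
-- (α_i) are the rational approximations of α.

posPart negPart : ℤ → ℕ
posPart (+ n)      = n
posPart -[1+ n ]   = 0
negPart (+ n)      = 0
negPart -[1+ n ]   = suc n

^-distribʳ-* : ∀ m n o → (m ℕ.* n) ℕ.^ o ≡ m ℕ.^ o ℕ.* n ℕ.^ o
^-distribʳ-* m n zero    = refl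
^-distribʳ-* m n (suc o) = trans (cong (m ℕ.* n ℕ.*_) (^-distribʳ-* m n o))
    (solve 4 (λ m n x y → m :* n :* (x :* y) := m :* x :* (n :* y)) refl m n (m ℕ.^ o) (n ℕ.^ o))
  where open ℕSolver.+-*-Solver

^-cancelʳ-≤ : ∀ o .{{_ : ℕ.NonZero o}} {m n} → m ℕ.^ o ℕ.≤ n ℕ.^ o → m ℕ.≤ n
^-cancelʳ-≤ o h = ℕ.≮⇒≥ λ n<m → ℕ.<-irrefl refl (ℕ.<-≤-trans (ℕ.^-monoˡ-< o n<m) h)

bernoulli : ∀ D m e → D ℕ.^ e ℕ.* (D ℕ.+ e ℕ.* m) ℕ.≤ D ℕ.* (D ℕ.+ m) ℕ.^ e
bernoulli D m zero    = ℕ.≤-reflexive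
    (solve 1 (λ D → con 1 :* (D :+ con 0) := D :* con 1) refl D)
  where open ℕSolver.+-*-Solver
bernoulli D m (suc e) = begin
    D ℕ.* D ℕ.^ e ℕ.* (D ℕ.+ (m ℕ.+ e ℕ.* m))
      ≤⟨ ℕ.m≤m+n _ (D ℕ.^ e ℕ.* (e ℕ.* m ℕ.* m)) ⟩
    D ℕ.* D ℕ.^ e ℕ.* (D ℕ.+ (m ℕ.+ e ℕ.* m)) ℕ.+ D ℕ.^ e ℕ.* (e ℕ.* m ℕ.* m)
      ≡⟨ solve 4 (λ D m e x → D :* x :* (D :+ (m :+ e :* m)) :+ x :* (e :* m :* m) :=
                              x :* (D :+ e :* m) :* (D :+ m)) refl D m e (D ℕ.^ e) ⟩
    D ℕ.^ e ℕ.* (D ℕ.+ e ℕ.* m) ℕ.* (D ℕ.+ m)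
      ≤⟨ ℕ.*-monoˡ-≤ (D ℕ.+ m) (bernoulli D m e) ⟩
    D ℕ.* (D ℕ.+ m) ℕ.^ e ℕ.* (D ℕ.+ m)
      ≡⟨ solve 3 (λ D s x → D :* x :* s := D :* (s :* x)) refl D (D ℕ.+ m) ((D ℕ.+ m) ℕ.^ e) ⟩
    D ℕ.* ((D ℕ.+ m) ℕ.* (D ℕ.+ m) ℕ.^ e) ∎
  where
  open ℕSolver.+-*-Solver
  open ℕ.≤-Reasoning

-- m^(1/D) ≤ 1 + m/D
root-bound : ∀ D .{{_ : ℕ.NonZero D}} m → D ℕ.^ D ℕ.* m ℕ.≤ (D ℕ.+ m) ℕ.^ D
root-bound D m = ℕ.*-cancelˡ-≤ D (begin
    D ℕ.* (D ℕ.^ D ℕ.* m)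
      ≤⟨ ℕ.m≤n+m _ (D ℕ.^ D ℕ.* D) ⟩
    D ℕ.^ D ℕ.* D ℕ.+ D ℕ.* (D ℕ.^ D ℕ.* m)
      ≡⟨ solve 3 (λ D m x → x :* D :+ D :* (x :* m) := x :* (D :+ D :* m)) refl D m (D ℕ.^ D) ⟩
    D ℕ.^ D ℕ.* (D ℕ.+ D ℕ.* m)
      ≤⟨ bernoulli D m D ⟩
    D ℕ.* (D ℕ.+ m) ℕ.^ D ∎)
  where
  open ℕSolver.+-*-Solver
  open ℕ.≤-Reasoning

greatest : ∀ {P : Pred ℕ 0ℓ} → Decidable P → ℕ → ℕ
greatest P? zero    = 0
greatest P? (suc b) = if does (P? (suc b)) then suc b else greatest P? b

-- t/J ≤ m^a, i.e. (t/J)^q ≤ m^z for a = z/q, cleared of denominators and of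
-- negative exponents.
Below : (m : ℕ) (a : ℚ) (J t : ℕ) → Set
Below m a J t = t ℕ.^ q ℕ.* m ℕ.^ negPart z ℕ.≤ J ℕ.^ q ℕ.* m ℕ.^ posPart z
  where
  q = ℚ.↧ₙ a
  z = ℚ.↥ a

below? : ∀ m a J → Decidable (Below m a J)
below? m a J t = _ ℕ.≤? _

-- The bound J·m^(z⁺) is at least J·m^a for positive m, so this is ⌊J·m^a⌋.
⌊_·_^_⌋ : (J m : ℕ) (a : ℚ) → ℕ
⌊ J · m ^ a ⌋ = greatest (below? m a J) (J ℕ.* m ℕ.^ posPart (ℚ.↥ a))

greatest-sat : ∀ {P : Pred ℕ 0ℓ} (P? : Decidable P) b → P 0 → P (greatest P? b)
greatest-sat P? zero    p0 = p0
greatest-sat P? (suc b) p0 with P? (suc b)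
... | yes p = p
... | no  _ = greatest-sat P? b p0

greatest-max : ∀ {P : Pred ℕ 0ℓ} (P? : Decidable P) b {t} → t ℕ.≤ b → P t → t ℕ.≤ greatest P? b
greatest-max P? zero    t≤b pt = t≤b
greatest-max P? (suc b) {t} t≤b pt with P? (suc b)
... | yes _ = t≤b
... | no ¬p with ℕ.m≤n⇒m<n∨m≡n t≤b
...   | inj₁ (s≤s t≤b′) = greatest-max P? b t≤b′ pt
...   | inj₂ refl       = contradiction pt ¬p

module _ (m : ℕ) .{{_ : ℕ.NonZero m}} (a : ℚ) (J : ℕ) where

  private
    p = posPart (ℚ.↥ a)
    n = negPart (ℚ.↥ a)
    q = ℚ.↧ₙ a
    t = ⌊ J · m ^ a ⌋

  ⌊⌋-below : t ℕ.^ q ℕ.* m ℕ.^ n ℕ.≤ J ℕ.^ q ℕ.* m ℕ.^ p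
  ⌊⌋-below = greatest-sat (below? m a J) (J ℕ.* m ℕ.^ p) z≤n

  ⌊⌋-above : J ℕ.^ q ℕ.* m ℕ.^ p ℕ.< suc t ℕ.^ q ℕ.* m ℕ.^ n
  ⌊⌋-above with suc t ℕ.≤? J ℕ.* m ℕ.^ p
  ... | yes le = ℕ.≰⇒> λ bel →
        ℕ.<-irrefl refl (greatest-max (below? m a J) (J ℕ.* m ℕ.^ p) le bel)
  ... | no ¬le = ℕ.≤-trans (ℕ.≤-trans (s≤s step₁) step₂)
                   (ℕ.≤-trans (ℕ.^-monoˡ-≤ q (ℕ.≰⇒> ¬le)) (ℕ.m≤m*n (suc t ℕ.^ q) (m ℕ.^ n) {{ℕ.m^n≢0 m n}}))
    where
    b = J ℕ.* m ℕ.^ p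
    r = ℚ.denominator-1 a
    step₁ : J ℕ.^ q ℕ.* m ℕ.^ p ℕ.≤ b ℕ.^ q
    step₁ = subst (J ℕ.^ q ℕ.* m ℕ.^ p ℕ.≤_) (sym (^-distribʳ-* J (m ℕ.^ p) q))
      (ℕ.*-monoʳ-≤ (J ℕ.^ q) (ℕ.m≤m*n (m ℕ.^ p) ((m ℕ.^ p) ℕ.^ r)
        {{ℕ.m^n≢0 (m ℕ.^ p) r {{ℕ.m^n≢0 m p}}}}))
    step₂ : suc (b ℕ.^ q) ℕ.≤ suc b ℕ.^ q
    step₂ = ℕ.^-monoˡ-< q (ℕ.n<1+n b)

raise : ∀ {m T I n p} q r N → q ℕ.* r ≡ N →
        T ℕ.^ q ℕ.* m ℕ.^ n ℕ.≤ I ℕ.^ q ℕ.* m ℕ.^ p →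
        T ℕ.^ N ℕ.* m ℕ.^ (n ℕ.* r) ℕ.≤ I ℕ.^ N ℕ.* m ℕ.^ (p ℕ.* r)
raise {m} {T} {I} {n} {p} q r _ refl h = subst₂ ℕ._≤_ (eq T n) (eq I p) (ℕ.^-monoˡ-≤ r h)
  where
  eq : ∀ x k → (x ℕ.^ q ℕ.* m ℕ.^ k) ℕ.^ r ≡ x ℕ.^ (q ℕ.* r) ℕ.* m ℕ.^ (k ℕ.* r)
  eq x k = trans (^-distribʳ-* (x ℕ.^ q) (m ℕ.^ k) r)
                 (cong₂ ℕ._*_ (ℕ.^-*-assoc x q r) (ℕ.^-*-assoc m k r))

-- If T/I ≤ m^((p-n)/q), m^((p′-n′)/q′) ≤ U/J and (p-n)/q ≤ (p′-n′)/q′ + 1/D,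
-- then T/I ≤ (U/J)(1 + m/D).
compare : ∀ m .{{_ : ℕ.NonZero m}} {T I p n U J p′ n′} q .{{_ : ℕ.NonZero q}}
  q′ .{{_ : ℕ.NonZero q′}} D .{{_ : ℕ.NonZero D}} →
  T ℕ.^ q ℕ.* m ℕ.^ n ℕ.≤ I ℕ.^ q ℕ.* m ℕ.^ p →
  J ℕ.^ q′ ℕ.* m ℕ.^ p′ ℕ.≤ U ℕ.^ q′ ℕ.* m ℕ.^ n′ →
  p ℕ.* (q′ ℕ.* D) ℕ.+ n′ ℕ.* (q ℕ.* D) ℕ.≤ n ℕ.* (q′ ℕ.* D) ℕ.+ p′ ℕ.* (q ℕ.* D) ℕ.+ q ℕ.* q′ →
  T ℕ.* J ℕ.* D ℕ.≤ U ℕ.* I ℕ.* (D ℕ.+ m)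
compare m {T} {I} {p} {n} {U} {J} {p′} {n′} q q′ D h₁ h₂ h₃ =
  ^-cancelʳ-≤ N (subst₂ ℕ._≤_ (sym (pow₃ T J D)) (sym (pow₃ U I (D ℕ.+ m)))
    (ℕ.*-cancelʳ-≤ (a ℕ.* c ℕ.* d) (u ℕ.* b ℕ.* e) (m ℕ.^ X) {{ℕ.m^n≢0 m X}} main))
  where
  open ℕSolver.+-*-Solver
  N = q ℕ.* (q′ ℕ.* D)
  instance
    N≢0 : ℕ.NonZero N
    N≢0 = ℕ.m*n≢0 q (q′ ℕ.* D) {{it}} {{ℕ.m*n≢0 q′ D}}
  a = T ℕ.^ N
  b = I ℕ.^ N
  c = J ℕ.^ N
  u = U ℕ.^ N
  d = D ℕ.^ N
  e = (D ℕ.+ m) ℕ.^ N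
  A = n ℕ.* (q′ ℕ.* D)
  B = p ℕ.* (q′ ℕ.* D)
  C = p′ ℕ.* (q ℕ.* D)
  E = n′ ℕ.* (q ℕ.* D)
  F = q ℕ.* q′
  X = A ℕ.+ C ℕ.+ F
  pow₃ : ∀ x y z → (x ℕ.* y ℕ.* z) ℕ.^ N ≡ x ℕ.^ N ℕ.* y ℕ.^ N ℕ.* z ℕ.^ N
  pow₃ x y z = trans (^-distribʳ-* (x ℕ.* y) z N) (cong (ℕ._* z ℕ.^ N) (^-distribʳ-* x y N))
  r₁ : a ℕ.* m ℕ.^ A ℕ.≤ b ℕ.* m ℕ.^ B
  r₁ = raise {m} {T} {I} {n} {p} q (q′ ℕ.* D) N refl h₁
  r₂ : c ℕ.* m ℕ.^ C ℕ.≤ u ℕ.* m ℕ.^ E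
  r₂ = raise {m} {J} {U} {p′} {n′} q′ (q ℕ.* D) N
    (solve 3 (λ q q′ D → q′ :* (q :* D) := q :* (q′ :* D)) refl q q′ D) h₂
  r₃ : d ℕ.* m ℕ.^ F ℕ.≤ e
  r₃ = subst₂ ℕ._≤_
    (trans (^-distribʳ-* (D ℕ.^ D) m F) (cong (ℕ._* m ℕ.^ F) (exp D)))
    (exp (D ℕ.+ m))
    (ℕ.^-monoˡ-≤ F (root-bound D m))
    where
    exp : ∀ x → (x ℕ.^ D) ℕ.^ F ≡ x ℕ.^ N
    exp x = trans (ℕ.^-*-assoc x D F) (cong (x ℕ.^_)
      (solve 3 (λ q q′ D → D :* (q :* q′) := q :* (q′ :* D)) refl q q′ D))
  main : a ℕ.* c ℕ.* d ℕ.* m ℕ.^ X ℕ.≤ u ℕ.* b ℕ.* e ℕ.* m ℕ.^ X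
  main = begin
    a ℕ.* c ℕ.* d ℕ.* m ℕ.^ X
      ≡⟨ cong (a ℕ.* c ℕ.* d ℕ.*_) (trans (ℕ.^-distribˡ-+-* m (A ℕ.+ C) F)
                                         (cong (ℕ._* m ℕ.^ F) (ℕ.^-distribˡ-+-* m A C))) ⟩
    a ℕ.* c ℕ.* d ℕ.* (m ℕ.^ A ℕ.* m ℕ.^ C ℕ.* m ℕ.^ F)
      ≡⟨ solve 6 (λ a c d x y z → a :* c :* d :* (x :* y :* z) := (a :* x) :* (c :* y) :* (d :* z))
           refl a c d (m ℕ.^ A) (m ℕ.^ C) (m ℕ.^ F) ⟩
    (a ℕ.* m ℕ.^ A) ℕ.* (c ℕ.* m ℕ.^ C) ℕ.* (d ℕ.* m ℕ.^ F)
      ≤⟨ ℕ.*-mono-≤ (ℕ.*-mono-≤ r₁ r₂) r₃ ⟩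
    (b ℕ.* m ℕ.^ B) ℕ.* (u ℕ.* m ℕ.^ E) ℕ.* e
      ≡⟨ solve 5 (λ b u e x y → (b :* x) :* (u :* y) :* e := u :* b :* e :* (x :* y))
           refl b u e (m ℕ.^ B) (m ℕ.^ E) ⟩
    u ℕ.* b ℕ.* e ℕ.* (m ℕ.^ B ℕ.* m ℕ.^ E)
      ≡⟨ cong (u ℕ.* b ℕ.* e ℕ.*_) (ℕ.^-distribˡ-+-* m B E) ⟨
    u ℕ.* b ℕ.* e ℕ.* m ℕ.^ (B ℕ.+ E)
      ≤⟨ ℕ.*-monoʳ-≤ (u ℕ.* b ℕ.* e) (ℕ.^-monoʳ-≤ m h₃) ⟩
    u ℕ.* b ℕ.* e ℕ.* m ℕ.^ X ∎
    where open ℕ.≤-Reasoning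

posPart-negPart : ∀ z → z ≡ + posPart z ℤ.- + negPart z
posPart-negPart (+ n)    = sym (ℤ.+-identityʳ (+ n))
posPart-negPart -[1+ n ] = refl

exponents : ∀ a b d → a ℚ.≤ b ℚ.+ + 1 ℚ./ suc d →
  let p = posPart (ℚ.↥ a); n = negPart (ℚ.↥ a); q = ℚ.↧ₙ a
      p′ = posPart (ℚ.↥ b); n′ = negPart (ℚ.↥ b); q′ = ℚ.↧ₙ b; D = suc d in
  p ℕ.* (q′ ℕ.* D) ℕ.+ n′ ℕ.* (q ℕ.* D) ℕ.≤ n ℕ.* (q′ ℕ.* D) ℕ.+ p′ ℕ.* (q ℕ.* D) ℕ.+ q ℕ.* q′
exponents a@(ℚ.mkℚ _ _ _) b@(ℚ.mkℚ _ _ _) d h = ℤ.drop‿+≤+ (subst₂ ℤ._≤_ lhs rhs (ℤ.+-monoʳ-≤ (+ n ℤ.* Q′D ℤ.+ + n′ ℤ.* QD) cleared))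
  where
  open ℤSolver.+-*-Solver
  p = posPart (ℚ.↥ a)
  n = negPart (ℚ.↥ a)
  q = ℚ.↧ₙ a
  p′ = posPart (ℚ.↥ b)
  n′ = negPart (ℚ.↥ b)
  q′ = ℚ.↧ₙ b
  D = suc d
  QD = + q ℤ.* + D
  Q′D = + q′ ℤ.* + D
  hᵘ : ℚ.toℚᵘ a ℚᵘ.≤ ℚ.toℚᵘ b ℚᵘ.+ ℚᵘ.mkℚᵘ (+ 1) d
  hᵘ = ℚᵘ.≤-trans (ℚ.toℚᵘ-mono-≤ h) (ℚᵘ.≤-reflexive
    (ℚᵘ.≃-trans (ℚ.toℚᵘ-homo-+ b (+ 1 ℚ./ suc d))
                (ℚᵘ.+-congʳ (ℚ.toℚᵘ b) (ℚ.toℚᵘ-fromℚᵘ (ℚᵘ.mkℚᵘ (+ 1) d)))))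
  raw : ℚ.↥ a ℤ.* + (q′ ℕ.* D) ℤ.≤ (ℚ.↥ b ℤ.* + D ℤ.+ + 1 ℤ.* + q′) ℤ.* + q
  raw = ℚᵘ.drop-*≤* hᵘ
  cleared : (+ p ℤ.- + n) ℤ.* Q′D ℤ.≤ ((+ p′ ℤ.- + n′) ℤ.* + D ℤ.+ + 1 ℤ.* + q′) ℤ.* + q
  cleared = subst₂ ℤ._≤_ (cong₂ ℤ._*_ (posPart-negPart (ℚ.↥ a)) (ℤ.pos-* q′ D))
    (cong (λ z → (z ℤ.* + D ℤ.+ + 1 ℤ.* + q′) ℤ.* + q) (posPart-negPart (ℚ.↥ b))) raw
  pos-** : ∀ x y z → + (x ℕ.* (y ℕ.* z)) ≡ + x ℤ.* (+ y ℤ.* + z)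
  pos-** x y z = trans (ℤ.pos-* x (y ℕ.* z)) (cong (+ x ℤ.*_) (ℤ.pos-* y z))
  lhs : (+ n ℤ.* Q′D ℤ.+ + n′ ℤ.* QD) ℤ.+ (+ p ℤ.- + n) ℤ.* Q′D
        ≡ + (p ℕ.* (q′ ℕ.* D) ℕ.+ n′ ℕ.* (q ℕ.* D))
  lhs = trans
    (solve 5 (λ p n n′ x y → (n :* y :+ n′ :* x) :+ (p :- n) :* y := p :* y :+ n′ :* x)
      refl (+ p) (+ n) (+ n′) QD Q′D)
    (sym (cong₂ ℤ._+_ (pos-** p q′ D) (pos-** n′ q D)))
  rhs : (+ n ℤ.* Q′D ℤ.+ + n′ ℤ.* QD) ℤ.+ ((+ p′ ℤ.- + n′) ℤ.* + D ℤ.+ + 1 ℤ.* + q′) ℤ.* + q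
        ≡ + (n ℕ.* (q′ ℕ.* D) ℕ.+ p′ ℕ.* (q ℕ.* D) ℕ.+ q ℕ.* q′)
  rhs = trans
    (solve 6 (λ n p′ n′ q q′ D →
        (n :* (q′ :* D) :+ n′ :* (q :* D)) :+ ((p′ :- n′) :* D :+ con (+ 1) :* q′) :* q
        := n :* (q′ :* D) :+ p′ :* (q :* D) :+ q :* q′)
      refl (+ n) (+ p′) (+ n′) (+ q) (+ q′) (+ D))
    (sym (cong₂ ℤ._+_ (cong₂ ℤ._+_ (pos-** n q′ D) (pos-** p′ q D)) (ℤ.pos-* q q′)))

powSeq : ℕ → ℝ → ℕ → ℚ
powSeq m α i = + ⌊ suc i · m ^ seq α i ⌋ ℚ./ suc i

module _ (m : ℕ) .{{_ : ℕ.NonZero m}} (α : ℝ) where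

  private
    P = powSeq m α

    -- compare, in ℚ, with D = 1+d
    step : ∀ i j d → ℚ.∣ seq α i ℚ.- seq α j ∣ ℚ.≤ 1/1+ d →
           P i ℚ.≤ (P j ℚ.+ 1/1+ j) ℚ.* (1ℚ ℚ.+ ι m ℚ.* 1/1+ d)
    step i j d h = subst (P i ℚ.≤_) eq
        (/-mono T i (U ℕ.* (suc d ℕ.+ m)) (d ℕ.+ j ℕ.* suc d) (begin
          T ℕ.* (suc j ℕ.* suc d)          ≡⟨ ℕ.*-assoc T (suc j) (suc d) ⟨
          T ℕ.* suc j ℕ.* suc d            ≤⟨ ineq ⟩
          U ℕ.* suc i ℕ.* (suc d ℕ.+ m)
            ≡⟨ trans (ℕ.*-assoc U (suc i) _)
                 (trans (cong (U ℕ.*_) (ℕ.*-comm (suc i) (suc d ℕ.+ m)))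
                        (sym (ℕ.*-assoc U (suc d ℕ.+ m) (suc i)))) ⟩
          U ℕ.* (suc d ℕ.+ m) ℕ.* suc i    ∎))
      where
      open ℕ.≤-Reasoning
      T = ⌊ suc i · m ^ seq α i ⌋
      U = suc ⌊ suc j · m ^ seq α j ⌋
      ineq : T ℕ.* suc j ℕ.* suc d ℕ.≤ U ℕ.* suc i ℕ.* (suc d ℕ.+ m)
      ineq = compare m {T} {suc i} {posPart (ℚ.↥ seq α i)} {negPart (ℚ.↥ seq α i)}
               {U} {suc j} {posPart (ℚ.↥ seq α j)} {negPart (ℚ.↥ seq α j)}
               (ℚ.↧ₙ seq α i) (ℚ.↧ₙ seq α j) (suc d)
               (⌊⌋-below m (seq α i) (suc i)) (ℕ.<⇒≤ (⌊⌋-above m (seq α j) (suc j)))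
               (exponents (seq α i) (seq α j) d
                 (p-q≤r⇒p≤q+r (ℚ.≤-trans (p≤∣p∣ (seq α i ℚ.- seq α j)) h)))
      eqU : + U ℚ./ suc j ≡ P j ℚ.+ 1/1+ j
      eqU = trans (frac≡ U j) (trans (cong (ℚ._* 1/1+ j) (ι-+ 1 ⌊ suc j · m ^ seq α j ⌋))
        (trans (ℚ.*-distribʳ-+ (1/1+ j) 1ℚ (ι ⌊ suc j · m ^ seq α j ⌋))
          (trans (ℚ.+-comm (1ℚ ℚ.* 1/1+ j) _)
            (cong₂ ℚ._+_ (sym (frac≡ ⌊ suc j · m ^ seq α j ⌋ j)) (ℚ.*-identityˡ (1/1+ j))))))
      eqD : + (suc d ℕ.+ m) ℚ./ suc d ≡ 1ℚ ℚ.+ ι m ℚ.* 1/1+ d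
      eqD = trans (frac≡ (suc d ℕ.+ m) d) (trans (cong (ℚ._* 1/1+ d) (ι-+ (suc d) m))
        (trans (ℚ.*-distribʳ-+ (1/1+ d) (ι (suc d)) (ι m))
          (cong (ℚ._+ ι m ℚ.* 1/1+ d) (ι-inv d))))
      eq : + (U ℕ.* (suc d ℕ.+ m)) ℚ./ (suc j ℕ.* suc d) ≡ (P j ℚ.+ 1/1+ j) ℚ.* (1ℚ ℚ.+ ι m ℚ.* 1/1+ d)
      eq = trans (sym (/-* U j (suc d ℕ.+ m) d)) (cong₂ ℚ._*_ eqU eqD)

    upper : ∃[ b ] ∃[ N ] ∀ i → N ℕ.≤ i → P i ℚ.+ 1/1+ i ℚ.≤ ι b
    upper =
      let N , h = cauchy α 1ℚ (ℚ.positive⁻¹ 1ℚ)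
          β = (P N ℚ.+ 1/1+ N) ℚ.* (1ℚ ℚ.+ ι m ℚ.* 1/1+ 0)
          b , le = ceil (β ℚ.+ 1/1+ 0)
      in b , N , λ i N≤i →
           ℚ.≤-trans (ℚ.+-mono-≤ (step i N 0 (h i N N≤i ℕ.≤-refl)) (1/1+-anti {0} {i} z≤n)) le

    close : ∀ {x y r K s ε} → 0ℚ ℚ.≤ s → x ℚ.≤ (y ℚ.+ r) ℚ.* (1ℚ ℚ.+ s) → y ℚ.+ r ℚ.≤ K →
            r ℚ.≤ ½ ℚ.* ε → K ℚ.* s ℚ.≤ ½ ℚ.* ε → x ℚ.≤ y ℚ.+ ε
    close {x} {y} {r} {K} {s} {ε} 0≤s h₁ h₂ h₃ h₄ = begin
        x                                  ≤⟨ h₁ ⟩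
        (y ℚ.+ r) ℚ.* (1ℚ ℚ.+ s)           ≡⟨ ℚ.*-distribˡ-+ (y ℚ.+ r) 1ℚ s ⟩
        (y ℚ.+ r) ℚ.* 1ℚ ℚ.+ (y ℚ.+ r) ℚ.* s
          ≤⟨ ℚ.+-mono-≤ (ℚ.≤-reflexive (ℚ.*-identityʳ (y ℚ.+ r)))
               (ℚ.≤-trans (ℚ.*-monoʳ-≤-nonNeg s {{ℚ.nonNegative 0≤s}} h₂) h₄) ⟩
        (y ℚ.+ r) ℚ.+ ½ ℚ.* ε              ≤⟨ ℚ.+-monoˡ-≤ (½ ℚ.* ε) (ℚ.+-monoʳ-≤ y h₃) ⟩
        (y ℚ.+ ½ ℚ.* ε) ℚ.+ ½ ℚ.* ε        ≡⟨ ℚ.+-assoc y (½ ℚ.* ε) (½ ℚ.* ε) ⟩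
        y ℚ.+ (½ ℚ.* ε ℚ.+ ½ ℚ.* ε)        ≡⟨ cong (y ℚ.+_) (half+half ε) ⟩
        y ℚ.+ ε                            ∎
      where open ℚ.≤-Reasoning

  powSeq-cauchy : ∀ ε → 0ℚ ℚ.< ε →
    ∃[ N ] ∀ i j → N ℕ.≤ i → N ℕ.≤ j → ℚ.∣ P i ℚ.- P j ∣ ℚ.≤ ε
  powSeq-cauchy ε 0<ε =
    let b , B , hB = upper
        d , hd = arch (b ℕ.* m) (½ ℚ.* ε) (half>0 0<ε)
        e , he = arch₁ (½ ℚ.* ε) (half>0 0<ε)
        M , hM = cauchy α (1/1+ d) (1/1+>0 d)
        L = e ⊔ M
        s≥0 = subst (0ℚ ℚ.≤_) (frac≡ m d) (/-mono 0 0 m d z≤n)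
        hs = subst (ℚ._≤ ½ ℚ.* ε)
               (trans (cong (ℚ._* 1/1+ d) (ι-* b m)) (ℚ.*-assoc (ι b) (ι m) (1/1+ d))) hd
        one : ∀ i j → B ⊔ L ℕ.≤ i → B ⊔ L ℕ.≤ j → P i ℚ.≤ P j ℚ.+ ε
        one = λ i j Ni Nj → close {P i} {P j} {1/1+ j} {ι b} {ι m ℚ.* 1/1+ d} {ε} s≥0
                (step i j d (hM i j (n≤⊔ e M (n≤⊔ B L Ni)) (n≤⊔ e M (n≤⊔ B L Nj))))
                (hB j (m≤⊔ B L Nj))
                (ℚ.≤-trans (1/1+-anti {e} {j} (m≤⊔ e M (n≤⊔ B L Nj))) he)
                hs
    in B ⊔ L , λ i j Ni Nj → ∣p-q∣≤ (one i j Ni Nj) (one j i Nj Ni)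

infixr 8 _^ᴿ_

-- The value at base 0 is arbitrary; cost below does not depend on it.
_^ᴿ_ : ℕ → ℝ → ℝ
zero      ^ᴿ α = 0ᴿ
m@(suc _) ^ᴿ α = mkℝ (powSeq m α) (powSeq-cauchy m α)

------------------------------------------------------------------------

partialSum : (ℕ → ℝ) → ℕ → ℝ
partialSum f zero    = 0ᴿ
partialSum f (suc N) = partialSum f N +ᴿ f N

infix 4 Σ∞_≤_ _≤Σ∞_

-- The sum of a series of nonnegative terms is the supremum of its partial sums
-- in [0,∞]; these two relations compare that supremum with a real, without
-- presupposing that it is finite.
Σ∞_≤_ : (ℕ → ℝ) → ℝ → Set
Σ∞ f ≤ c = ∀ N → partialSum f N ≤ᴿ c

_≤Σ∞_ : ℝ → (ℕ → ℝ) → Set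
c ≤Σ∞ f = ∀ ε → 0ℚ ℚ.< ε → ∃[ N ] c ≤ᴿ partialSum f N +ᴿ fromℚ ε

------------------------------------------------------------------------

record Hypergraph (n k : ℕ) : Set where
  field
    edges   : List (Subset n)
    unique  : Unique edges
    uniform : All (λ e → ∣ e ∣ ≡ k) edges

open Hypergraph public

e[_] : ∀ {n k} → Hypergraph n k → ℕ
e[ G ] = length (edges G)

record Query (n k : ℕ) : Set where
  field
    parts    : Vec (Subset n) k
    disjoint : AllPairs (λ S T → Empty (S ∩ T)) parts

open Query public

querySize : ∀ {n k} → Query n k → ℕ
querySize q = Vec.sum (Vec.map ∣_∣ (parts q))

Rainbow : ∀ {n k} → Query n k → Subset n → Set
Rainbow q e = VAll.All (λ S → ∣ S ∩ e ∣ ≡ 1) (parts q)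

rainbow? : ∀ {n k} (q : Query n k) → Decidable (Rainbow q)
rainbow? q e = VAll.all? (λ S → ∣ S ∩ e ∣ ℕ.≟ 1) (parts q)

cIND : ∀ {n k} → Hypergraph n k → Query n k → Bool
cIND G q = not (does (any? (rainbow? q) (edges G)))

------------------------------------------------------------------------

-- On a given input (n, k), a deterministic algorithm is a decision tree: it
-- either halts with an output (coded as a natural number) or makes a query and
-- continues according to the answer.
data DecisionTree (n k : ℕ) : Set where
  output : ℕ → DecisionTree n k
  query  : Query n k → (Bool → DecisionTree n k) → DecisionTree n k

DetAlg : Set
DetAlg = ∀ n k → DecisionTree n k

run : ∀ {n k} → DecisionTree n k → (Query n k → Bool) → ℕ
run (output r)  O = r
run (query q t) O = run (t (O q)) O

cost : ℝ → ℕ → ℝ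
cost α zero      = 0ᴿ
cost α m@(suc _) = m ^ᴿ α

oracleCost : ∀ {n k} → ℝ → DecisionTree n k → (Query n k → Bool) → ℝ
oracleCost α (output r)  O = 0ᴿ
oracleCost α (query q t) O = cost α (querySize q) +ᴿ oracleCost α (t (O q)) O

-- A discrete distribution has countable support: alg i is drawn with
-- probability prob i. Terms may repeat or have probability 0.
record RandAlg : Set where
  field
    prob    : ℕ → ℝ
    alg     : ℕ → DetAlg
    prob≥0  : ∀ i → 0ᴿ ≤ᴿ prob i
    total≤1 : Σ∞ prob ≤ 1ᴿ
    total≥1 : 1ᴿ ≤Σ∞ prob

open RandAlg public

indicator : ∀ {P : Set} → Dec P → ℝ
indicator P? = if does P? then 1ᴿ else 0ᴿ

PrAtLeast : RandAlg → {P : Pred DetAlg 0ℓ} → Decidable P → ℝ → Set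
PrAtLeast 𝒜 P? c = c ≤Σ∞ (λ i → prob 𝒜 i *ᴿ indicator (P? (alg 𝒜 i)))

ExpectedCostAtMost : ∀ {n k} → ℝ → RandAlg → Hypergraph n k → ℝ → Set
ExpectedCostAtMost {n} {k} α 𝒜 G C =
  Σ∞ (λ i → prob 𝒜 i *ᴿ oracleCost α (alg 𝒜 i n k) (cIND G)) ≤ C

WorstCaseExpectedCostAtMost : ℕ → ℕ → ℝ → RandAlg → ℝ → Set
WorstCaseExpectedCostAtMost n k α 𝒜 C = (G : Hypergraph n k) → ExpectedCostAtMost α 𝒜 G C

Correct : ∀ {n k} → Hypergraph n k → Pred DetAlg 0ℓ
Correct {n} {k} G A = run (A n k) (cIND G) ≡ 1 ⇔ 0 ℕ.< e[ G ]

correct? : ∀ {n k} (G : Hypergraph n k) → Decidable (Correct G)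
correct? {n} {k} G A =
  Dec.map′ (λ (f , g) → mk⇔ f g) (λ iff → Equivalence.to iff , Equivalence.from iff)
    ((returns1? →-dec nonempty?) ×-dec (nonempty? →-dec returns1?))
  where
  returns1? = run (A n k) (cIND G) ℕ.≟ 1
  nonempty? = 0 ℕ.<? e[ G ]

module Submission where

-- Compare the edgeless hypergraph with the N = C(n,k) hypergraphs that have a
-- single edge e. Let s be the total size of a query. If the query distinguishes
-- the two, then e is rainbow for it, so e is contained in the union of its disjoint
-- parts, which has s elements (rainbow⇒⊆union). Hence at most C(s,k) of the
-- N edges are detected by the query (count-rainbow), and
--
--   C(s,k) / C(n,k) ≤ (s/n)^k ≤ (s/n)^α
--
-- as s ≤ n and α ≤ k (binomial-ratio, pow-ratio). So n^α times the fraction of edges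
-- detected by a query is at most its cost. A deterministic algorithm that does not
-- report an edge on the edgeless hypergraph can report the edge e only if one of the
-- queries that it makes on the edgeless hypergraph detects e. Therefore n^α times
-- the fraction of edges that it finds is at most c, its cost on the edgeless
-- hypergraph (found-≤-cost).
--
-- Instead of a random edge, use a list of 2N test inputs: the edgeless hypergraph N
-- times and each single-edge hypergraph once. With R = n^α, every deterministic
-- algorithm that is correct on a of them satisfies R a ≤ N (R + c) (correctOn-≤).
-- Averaging over the distribution of the randomised algorithm bounds the right-hand
-- side by N (R + C), while a has expectation at least 9/10 of 2N. Since expectations
-- are suprema of partial sums, only finitely many algorithms are considered, at a
-- loss of 1/10 in each of the finitely many success probabilities (common-stage).
-- This gives 16/10 R ≤ R + C, that is, C ≥ 6/10 n^α.
--
-- Two of the steps need estimates for the rational approximations of reals, whose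
-- terms satisfy the inequalities between the reals only up to an error: that
-- multiplication by a nonnegative real is monotone (*-mono-approx), and that
-- n^α C(s,k) ≤ C(n,k) s^α (pow-ratio-approx).

open import Data.Integer.Base using (+_)
open import Data.Nat.Base using (ℕ; _≤_; NonZero)
open import Data.Rational.Base using (_/_)
open import Defs

open import Algebra.Bundles using (CommutativeSemiring)
import Algebra.Solver.Ring.NaturalCoefficients.Default as SemiringSolver
open import Data.Bool.Base using (Bool; true; false; not)
open import Data.Fin.Subset using (Subset; Empty; inside; outside; _∈_; _⊆_; _∩_; _∪_; ∣_∣; ⊥)
import Data.Fin.Subset.Properties as Sub
open import Data.List.Base using (List; []; _∷_; _++_; map; filter; length; replicate)
import Data.List.Properties as List
open import Data.List.Relation.Unary.All as All using (All; []; _∷_)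
import Data.List.Relation.Unary.All.Properties as All
open import Data.List.Relation.Unary.AllPairs using ([]; _∷_)
open import Data.List.Relation.Unary.Any using (here; any?)
open import Data.Nat.Base using (zero; suc; _+_; _*_; _∸_; _^_; z≤n; s≤s; >-nonZero; _⊔_)
open import Data.Nat.Combinatorics using (nCk+nC[k+1]≡[n+1]C[k+1])
  renaming (_C_ to _choose_)
open import Data.Nat.Coprimality using (1-coprimeTo) renaming (sym to coprime-sym)
import Data.Nat.Properties as ℕ
import Data.Nat.Solver as ℕSolver
open import Data.Product.Base using (∃-syntax; _,_; proj₁; proj₂)
open import Data.Rational.Base as ℚ using (ℚ; 0ℚ; 1ℚ; ½)
import Data.Rational.Properties as ℚ
import Data.Rational.Solver as ℚSolver
open import Data.Sum.Base using (_⊎_; inj₁; inj₂)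
open import Data.Vec.Base as Vec using (Vec; []; _∷_; here; there)
import Data.Vec.Relation.Unary.All as VAll
open import Data.Vec.Relation.Unary.AllPairs using (AllPairs; []; _∷_)
open import Function.Base using (_∘_)
open import Function.Bundles using (Equivalence)
open import Level using (0ℓ)
open import Relation.Binary.Bundles using (Preorder)
open import Relation.Binary.PropositionalEquality
import Relation.Binary.Reasoning.Preorder as PreorderReasoning
open import Relation.Nullary using (Dec; ¬_; contradiction; does; yes; no)
open import Relation.Nullary.Decidable using (dec-false; toWitness)
open import Relation.Unary using (Pred; Decidable)

open RationalLemmas

------------------------------------------------------------------------
-- Binomial coefficients

private
  variable
    A B : Set
    n k : ℕ

-- The absorption identity (k+1) C(n,k+1) = (n-k) C(n,k), free of subtraction.
nCk-absorb : ∀ n k → suc k * (n choose suc k) + k * (n choose k) ≡ n * (n choose k)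
nCk-absorb zero    zero    = refl
nCk-absorb zero    (suc k) = cong₂ _+_ (ℕ.*-zeroʳ (suc (suc k))) (ℕ.*-zeroʳ (suc k))
nCk-absorb (suc n) zero    = begin
    1 * (suc n choose 1) + 0    ≡⟨ cong (λ x → 1 * x + 0) (nCk+nC[k+1]≡[n+1]C[k+1] n 0) ⟨
    1 * (1 + (n choose 1)) + 0
      ≡⟨ solve 1 (λ x → con 1 :* (con 1 :+ x) :+ con 0 := con 1 :+ (con 1 :* x :+ con 0))
           refl (n choose 1) ⟩
    suc (1 * (n choose 1) + 0)  ≡⟨ cong suc (nCk-absorb n 0) ⟩
    suc (n * 1)                 ∎
  where
  open ≡-Reasoning
  open ℕSolver.+-*-Solver
nCk-absorb (suc n) (suc k) = begin
    suc (suc k) * (suc n choose suc (suc k)) + suc k * (suc n choose suc k)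
      ≡⟨ cong₂ (λ x y → suc (suc k) * x + suc k * y) (pascal (suc k)) (pascal k) ⟨
    suc (suc k) * (b + c) + suc k * (a + b)
      ≡⟨ solve 4 (λ k a b c → (con 2 :+ k) :* (b :+ c) :+ (con 1 :+ k) :* (a :+ b) :=
           b :+ (((con 2 :+ k) :* c :+ (con 1 :+ k) :* b) :+ (((con 1 :+ k) :* b :+ k :* a) :+ a)))
           refl k a b c ⟩
    b + ((suc (suc k) * c + suc k * b) + ((suc k * b + k * a) + a))
      ≡⟨ cong₂ (λ x y → b + (x + (y + a))) (nCk-absorb n (suc k)) (nCk-absorb n k) ⟩
    b + (n * b + (n * a + a))
      ≡⟨ solve 3 (λ n a b → b :+ (n :* b :+ (n :* a :+ a)) := (con 1 :+ n) :* (a :+ b)) refl n a b ⟩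
    suc n * (a + b)             ≡⟨ cong (suc n *_) (pascal k) ⟩
    suc n * (suc n choose suc k) ∎
  where
  open ≡-Reasoning
  open ℕSolver.+-*-Solver
  pascal = nCk+nC[k+1]≡[n+1]C[k+1] n
  a = n choose k
  b = n choose suc k
  c = n choose suc (suc k)

nC[k+1]-rec : ∀ n k → suc k * (n choose suc k) ≡ (n ∸ k) * (n choose k)
nC[k+1]-rec n k = begin
    suc k * (n choose suc k)
      ≡⟨ ℕ.m+n∸n≡m (suc k * (n choose suc k)) (k * (n choose k)) ⟨
    suc k * (n choose suc k) + k * (n choose k) ∸ k * (n choose k)
      ≡⟨ cong (_∸ k * (n choose k)) (nCk-absorb n k) ⟩
    n * (n choose k) ∸ k * (n choose k)
      ≡⟨ ℕ.*-distribʳ-∸ (n choose k) n k ⟨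
    (n ∸ k) * (n choose k) ∎
  where open ≡-Reasoning

-- C(s,k) / C(n,k) ≤ (s/n)^k: the factors (s-i)/(n-i) of the left-hand side are
-- at most s/n. Truncated subtraction makes it hold for k > s too.
binomial-ratio : ∀ {s n} k → s ≤ n → (s choose k) * n ^ k ≤ (n choose k) * s ^ k
binomial-ratio         zero    s≤n = ℕ.≤-refl
binomial-ratio {s} {n} (suc k) s≤n = ℕ.*-cancelˡ-≤ (suc k) (begin
    suc k * ((s choose suc k) * (n * n ^ k))   ≡⟨ ℕ.*-assoc (suc k) (s choose suc k) _ ⟨
    suc k * (s choose suc k) * (n * n ^ k)     ≡⟨ cong (_* (n * n ^ k)) (nC[k+1]-rec s k) ⟩
    (s ∸ k) * (s choose k) * (n * n ^ k)       ≡⟨ swap (s ∸ k) (s choose k) n (n ^ k) ⟩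
    n * (s ∸ k) * ((s choose k) * n ^ k)       ≤⟨ ℕ.*-mono-≤ step (binomial-ratio k s≤n) ⟩
    s * (n ∸ k) * ((n choose k) * s ^ k)       ≡⟨ swap (n ∸ k) (n choose k) s (s ^ k) ⟨
    (n ∸ k) * (n choose k) * (s * s ^ k)       ≡⟨ cong (_* (s * s ^ k)) (nC[k+1]-rec n k) ⟨
    suc k * (n choose suc k) * (s * s ^ k)     ≡⟨ ℕ.*-assoc (suc k) (n choose suc k) _ ⟩
    suc k * ((n choose suc k) * (s * s ^ k))   ∎)
  where
  open ℕ.≤-Reasoning
  open ℕSolver.+-*-Solver
  swap : ∀ a b c d → a * b * (c * d) ≡ c * a * (b * d)
  swap = solve 4 (λ a b c d → a :* b :* (c :* d) := c :* a :* (b :* d)) refl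
  step : n * (s ∸ k) ≤ s * (n ∸ k)
  step = begin
    n * (s ∸ k)   ≡⟨ ℕ.*-distribˡ-∸ n s k ⟩
    n * s ∸ n * k ≤⟨ ℕ.∸-mono (ℕ.≤-reflexive (ℕ.*-comm n s)) (ℕ.*-monoˡ-≤ k s≤n) ⟩
    s * n ∸ s * k ≡⟨ ℕ.*-distribˡ-∸ s n k ⟨
    s * (n ∸ k)   ∎

nCk>0 : ∀ {n k} → k ≤ n → 1 ≤ (n choose k)
nCk>0 {n}     {zero}  _         = ℕ.≤-refl
nCk>0 {suc n} {suc k} (s≤s k≤n) = ℕ.≤-trans (nCk>0 k≤n)
  (ℕ.≤-trans (ℕ.m≤m+n (n choose k) (n choose suc k)) (ℕ.≤-reflexive (nCk+nC[k+1]≡[n+1]C[k+1] n k)))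

------------------------------------------------------------------------
-- Counting list entries

-- The number of entries of a list that satisfy a decidable predicate.
count : {P : Pred A 0ℓ} → Decidable P → List A → ℕ
count P? xs = length (filter P? xs)

count-mono : {P Q : Pred A 0ℓ} (P? : Decidable P) (Q? : Decidable Q) →
             (∀ x → P x → Q x) → ∀ xs → count P? xs ≤ count Q? xs
count-mono P? Q? P⊆Q []       = z≤n
count-mono P? Q? P⊆Q (x ∷ xs) with ih ← count-mono P? Q? P⊆Q xs | P? x | Q? x
... | yes p | yes q = s≤s ih
... | yes p | no ¬q = contradiction (P⊆Q x p) ¬q
... | no ¬p | yes q = ℕ.m≤n⇒m≤1+n ih
... | no ¬p | no ¬q = ih

count-∪ : {P Q R : Pred A 0ℓ} (P? : Decidable P) (Q? : Decidable Q) (R? : Decidable R) →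
          (∀ x → P x → Q x ⊎ R x) → ∀ xs → count P? xs ≤ count Q? xs + count R? xs
count-∪ P? Q? R? h []       = z≤n
count-∪ P? Q? R? h (x ∷ xs) with ih ← count-∪ P? Q? R? h xs | P? x | Q? x | R? x
... | no ¬p | yes _ | yes _ = ℕ.m≤n⇒m≤1+n (ℕ.≤-trans ih (ℕ.+-monoʳ-≤ _ (ℕ.n≤1+n _)))
... | no ¬p | yes _ | no _  = ℕ.m≤n⇒m≤1+n ih
... | no ¬p | no _  | yes _ = ℕ.≤-trans ih (ℕ.+-monoʳ-≤ _ (ℕ.n≤1+n _))
... | no ¬p | no _  | no _  = ih
... | yes p | yes _ | yes _ = s≤s (ℕ.≤-trans ih (ℕ.+-monoʳ-≤ _ (ℕ.n≤1+n _)))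
... | yes p | yes _ | no _  = s≤s ih
... | yes p | no _  | yes _ = ℕ.≤-trans (s≤s ih) (ℕ.≤-reflexive (sym (ℕ.+-suc _ _)))
... | yes p | no ¬q | no ¬r with h x p
...   | inj₁ q = contradiction q ¬q
...   | inj₂ r = contradiction r ¬r

count-none : {P : Pred A 0ℓ} (P? : Decidable P) → (∀ x → ¬ P x) → ∀ xs → count P? xs ≡ 0
count-none P? ¬P xs = cong length (List.filter-none P? (All.universal ¬P xs))

count-map : {P : Pred B 0ℓ} (P? : Decidable P) (f : A → B) → ∀ xs →
            count P? (map f xs) ≡ count (P? ∘ f) xs
count-map P? f []       = refl
count-map P? f (x ∷ xs) with does (P? (f x))
... | true  = cong suc (count-map P? f xs)
... | false = count-map P? f xs

count-++ : {P : Pred A 0ℓ} (P? : Decidable P) → ∀ xs ys →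
           count P? (xs ++ ys) ≡ count P? xs + count P? ys
count-++ P? xs ys = trans (cong length (List.filter-++ P? xs ys)) (List.length-++ (filter P? xs))

------------------------------------------------------------------------
-- The k-subsets of an n-set

-- The possible edges of a k-hypergraph on n vertices.
KSubset : ℕ → ℕ → Set
KSubset n k = ∃[ e ] ∣_∣ {n} e ≡ k

without-first : KSubset n k → KSubset (suc n) k
without-first (e , ∣e∣) = outside ∷ e , ∣e∣

with-first : KSubset n k → KSubset (suc n) (suc k)
with-first (e , ∣e∣) = inside ∷ e , cong suc ∣e∣

-- All k-subsets, listed by whether they contain the first vertex.
kSubsets : ∀ n k → List (KSubset n k)
kSubsets zero    zero    = ([] , refl) ∷ []
kSubsets zero    (suc k) = []
kSubsets (suc n) zero    = map without-first (kSubsets n 0)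
kSubsets (suc n) (suc k) =
  map with-first (kSubsets n k) ++
  map without-first (kSubsets n (suc k))

length-kSubsets : ∀ n k → length (kSubsets n k) ≡ (n choose k)
length-kSubsets zero    zero    = refl
length-kSubsets zero    (suc k) = refl
length-kSubsets (suc n) zero    = trans (List.length-map _ (kSubsets n 0)) (length-kSubsets n 0)
length-kSubsets (suc n) (suc k) = begin
    length (map _ (kSubsets n k) ++ map _ (kSubsets n (suc k)))
      ≡⟨ List.length-++ (map _ (kSubsets n k)) ⟩
    length (map _ (kSubsets n k)) + length (map _ (kSubsets n (suc k)))
      ≡⟨ cong₂ _+_ (trans (List.length-map _ (kSubsets n k)) (length-kSubsets n k))
                   (trans (List.length-map _ (kSubsets n (suc k))) (length-kSubsets n (suc k))) ⟩
    (n choose k) + (n choose suc k)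
      ≡⟨ nCk+nC[k+1]≡[n+1]C[k+1] n k ⟩
    (suc n choose suc k) ∎
  where open ≡-Reasoning

within? : (U : Subset n) → Decidable (λ (e : KSubset n k) → proj₁ e ⊆ U)
within? U (e , _) = e Sub.⊆? U

count-within : ∀ k (U : Subset n) → count (within? U) (kSubsets n k) ≤ (∣ U ∣ choose k)
count-within zero [] = List.length-filter (within? []) (kSubsets 0 0)
count-within (suc k) [] = z≤n
count-within {suc n} zero (x ∷ U) = begin
    count (within? (x ∷ U)) (map _ (kSubsets n 0)) ≡⟨ count-map (within? (x ∷ U)) _ (kSubsets n 0) ⟩
    count (within? (x ∷ U) ∘ without-first) (kSubsets n 0)
      ≤⟨ count-mono _ (within? U) (λ _ → Sub.drop-∷-⊆) (kSubsets n 0) ⟩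
    count (within? U) (kSubsets n 0)               ≤⟨ count-within 0 U ⟩
    1                                              ∎
  where open ℕ.≤-Reasoning
count-within {suc n} (suc k) (x ∷ U) = begin
    count (within? (x ∷ U)) (kSubsets (suc n) (suc k))
      ≡⟨ count-++ (within? (x ∷ U)) (map _ (kSubsets n k)) _ ⟩
    count (within? (x ∷ U)) (map _ (kSubsets n k)) + count (within? (x ∷ U)) (map _ (kSubsets n (suc k)))
      ≡⟨ cong₂ _+_ (count-map (within? (x ∷ U)) _ (kSubsets n k))
                   (count-map (within? (x ∷ U)) _ (kSubsets n (suc k))) ⟩
    count (within? (x ∷ U) ∘ with-first) (kSubsets n k) +
    count (within? (x ∷ U) ∘ without-first) (kSubsets n (suc k))
      ≤⟨ ℕ.+-mono-≤ (ins x) (ℕ.≤-trans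
           (count-mono _ (within? U) (λ _ → Sub.drop-∷-⊆) (kSubsets n (suc k)))
           (count-within (suc k) U)) ⟩
    containing x + (∣ U ∣ choose suc k)
      ≡⟨ pascal x ⟩
    (∣ x ∷ U ∣ choose suc k) ∎
  where
  open ℕ.≤-Reasoning
  containing : Bool → ℕ
  containing true  = ∣ U ∣ choose k
  containing false = 0
  ins : ∀ x → count (within? (x ∷ U) ∘ with-first) (kSubsets n k) ≤ containing x
  ins true  = ℕ.≤-trans (count-mono _ (within? U) (λ _ → Sub.drop-∷-⊆) (kSubsets n k)) (count-within k U)
  ins false = ℕ.≤-reflexive (count-none _ (λ _ h → contradiction (h here) λ ()) (kSubsets n k))
  pascal : ∀ x → containing x + (∣ U ∣ choose suc k) ≡ (∣ x ∷ U ∣ choose suc k)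
  pascal true  = nCk+nC[k+1]≡[n+1]C[k+1] ∣ U ∣ k
  pascal false = refl

------------------------------------------------------------------------
-- Queries and rainbow edges

-- The union of a vector of subsets, such as the parts of a query.
union : ∀ {m} → Vec (Subset n) m → Subset n
union = Vec.foldr _ _∪_ ⊥

∣∪∣-disjoint : (S T : Subset n) → Empty (S ∩ T) → ∣ S ∪ T ∣ ≡ ∣ S ∣ + ∣ T ∣
∣∪∣-disjoint []           []           _ = refl
∣∪∣-disjoint (true ∷ S)  (true ∷ T)  d = contradiction (_ , here) d
∣∪∣-disjoint (true ∷ S)  (false ∷ T) d = cong suc (∣∪∣-disjoint S T λ (x , h) → d (_ , there h))
∣∪∣-disjoint (false ∷ S) (true ∷ T)  d =
  trans (cong suc (∣∪∣-disjoint S T λ (x , h) → d (_ , there h))) (sym (ℕ.+-suc ∣ S ∣ ∣ T ∣))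
∣∪∣-disjoint (false ∷ S) (false ∷ T) d = ∣∪∣-disjoint S T λ (x , h) → d (_ , there h)

disjoint-union : ∀ {m} (S : Subset n) (Ts : Vec (Subset n) m) →
                 VAll.All (λ T → Empty (S ∩ T)) Ts → Empty (S ∩ union Ts)
disjoint-union S [] VAll.[] (x , x∈) = Sub.∉⊥ (proj₂ (Sub.x∈p∩q⁻ S _ x∈))
disjoint-union S (T ∷ Ts) (d VAll.∷ ds) (x , x∈) with Sub.x∈p∩q⁻ S _ x∈
... | x∈S , x∈U with Sub.x∈p∪q⁻ T (union Ts) x∈U
...   | inj₁ x∈T  = d (x , Sub.x∈p∩q⁺ (x∈S , x∈T))
...   | inj₂ x∈Ts = disjoint-union S Ts ds (x , Sub.x∈p∩q⁺ (x∈S , x∈Ts))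

-- For disjoint parts, the intersection of their union with e is counted part by part.
∣union∩∣ : ∀ {m} (Ss : Vec (Subset n) m) → AllPairs (λ S T → Empty (S ∩ T)) Ss → ∀ e →
           ∣ union Ss ∩ e ∣ ≡ Vec.sum (Vec.map (λ S → ∣ S ∩ e ∣) Ss)
∣union∩∣ {n} [] [] e = trans (cong ∣_∣ (Sub.∩-zeroˡ e)) (Sub.∣⊥∣≡0 n)
∣union∩∣ (S ∷ Ss) (d ∷ ds) e = begin
    ∣ (S ∪ union Ss) ∩ e ∣            ≡⟨ cong ∣_∣ (Sub.∩-distribʳ-∪ e S (union Ss)) ⟩
    ∣ (S ∩ e) ∪ (union Ss ∩ e) ∣
      ≡⟨ ∣∪∣-disjoint (S ∩ e) (union Ss ∩ e) (disjoint-union S Ss d ∘ shrink) ⟩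
    ∣ S ∩ e ∣ + ∣ union Ss ∩ e ∣      ≡⟨ cong (λ m → ∣ S ∩ e ∣ + m) (∣union∩∣ Ss ds e) ⟩
    ∣ S ∩ e ∣ + Vec.sum (Vec.map (λ S → ∣ S ∩ e ∣) Ss) ∎
  where
  open ≡-Reasoning
  shrink : ∃[ x ] x ∈ (S ∩ e) ∩ (union Ss ∩ e) → ∃[ x ] x ∈ S ∩ union Ss
  shrink (x , h) with Sub.x∈p∩q⁻ (S ∩ e) (union Ss ∩ e) h
  ... | a , b = x , Sub.x∈p∩q⁺ (Sub.p∩q⊆p S e a , Sub.p∩q⊆p (union Ss) e b)

querySize≡∣union∣ : (q : Query n k) → querySize q ≡ ∣ union (parts q) ∣
querySize≡∣union∣ {n} q = go (parts q) (disjoint q)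
  where
  go : ∀ {m} (Ss : Vec (Subset n) m) → AllPairs (λ S T → Empty (S ∩ T)) Ss →
       Vec.sum (Vec.map ∣_∣ Ss) ≡ ∣ union Ss ∣
  go []       []       = sym (Sub.∣⊥∣≡0 n)
  go (S ∷ Ss) (d ∷ ds) = trans (cong (λ m → ∣ S ∣ + m) (go Ss ds))
    (sym (∣∪∣-disjoint S (union Ss) (disjoint-union S Ss d)))

querySize≤n : (q : Query n k) → querySize q ≤ n
querySize≤n q = subst (_≤ _) (sym (querySize≡∣union∣ q)) (Sub.∣p∣≤n (union (parts q)))

∣p∩q∣≡∣q∣⇒q⊆p : (p q : Subset n) → ∣ p ∩ q ∣ ≡ ∣ q ∣ → q ⊆ p
∣p∩q∣≡∣q∣⇒q⊆p (true ∷ p) (true ∷ q) h here = here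
∣p∩q∣≡∣q∣⇒q⊆p (true ∷ p) (true ∷ q) h (there x∈q) = there (∣p∩q∣≡∣q∣⇒q⊆p p q (ℕ.suc-injective h) x∈q)
∣p∩q∣≡∣q∣⇒q⊆p (false ∷ p) (true ∷ q) h _ = contradiction (Sub.∣p∩q∣≤∣q∣ p q) (ℕ.<⇒≱ (ℕ.≤-reflexive (sym h)))
∣p∩q∣≡∣q∣⇒q⊆p (true ∷ p) (false ∷ q) h (there x∈q) = there (∣p∩q∣≡∣q∣⇒q⊆p p q h x∈q)
∣p∩q∣≡∣q∣⇒q⊆p (false ∷ p) (false ∷ q) h (there x∈q) = there (∣p∩q∣≡∣q∣⇒q⊆p p q h x∈q)

-- A rainbow e has exactly one vertex in each of the k disjoint parts, so all of
-- its k vertices lie in their union.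
rainbow⇒⊆union : (q : Query n k) (e : KSubset n k) → Rainbow q (proj₁ e) → proj₁ e ⊆ union (parts q)
rainbow⇒⊆union q (e , ∣e∣) r = ∣p∩q∣≡∣q∣⇒q⊆p (union (parts q)) e
  (trans (∣union∩∣ (parts q) (disjoint q) e) (trans (ones (parts q) r) (sym ∣e∣)))
  where
  ones : ∀ {m} (Ss : Vec (Subset _) m) → VAll.All (λ S → ∣ S ∩ e ∣ ≡ 1) Ss →
         Vec.sum (Vec.map (λ S → ∣ S ∩ e ∣) Ss) ≡ m
  ones []       VAll.[]         = refl
  ones (S ∷ Ss) (h VAll.∷ hs) = cong₂ _+_ h (ones Ss hs)

-- The edges that are rainbow for a query of size s are k-subsets of an s-set.
count-rainbow : (q : Query n k) →
  count (λ (e , _) → rainbow? q e) (kSubsets n k) ≤ (querySize q choose k)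
count-rainbow {n} {k} q = begin
    count (λ (e , _) → rainbow? q e) (kSubsets n k)
      ≤⟨ count-mono _ (within? (union (parts q))) (rainbow⇒⊆union q) (kSubsets n k) ⟩
    count (within? (union (parts q))) (kSubsets n k) ≤⟨ count-within k (union (parts q)) ⟩
    (∣ union (parts q) ∣ choose k)                   ≡⟨ cong (_choose k) (querySize≡∣union∣ q) ⟨
    (querySize q choose k)                           ∎
  where open ℕ.≤-Reasoning

------------------------------------------------------------------------
-- The ordered semiring of reals

private
  variable
    x y z u v : ℝ

-- Termwise equality of the approximating sequences. It is finer than equality of
-- reals, but it is the equality for which the operations satisfy the semiring
-- laws on the nose, which makes the semiring solver available. Neither _≈_ nor _≤ᴿ_
-- determines the reals that it relates, since it unfolds to a statement about their
-- sequences; hence the explicit arguments in what follows.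
infix 4 _≈_

_≈_ : ℝ → ℝ → Set
x ≈ y = ∀ i → seq x i ≡ seq y i

ℝ-commutativeSemiring : CommutativeSemiring 0ℓ 0ℓ
ℝ-commutativeSemiring = record
  { Carrier = ℝ
  ; _≈_ = _≈_
  ; _+_ = _+ᴿ_
  ; _*_ = _*ᴿ_
  ; 0# = 0ᴿ
  ; 1# = 1ᴿ
  ; isCommutativeSemiring = record
    { isSemiring = record
      { isSemiringWithoutAnnihilatingZero = record
        { +-isCommutativeMonoid = record
          { isMonoid = record
            { isSemigroup = record
              { isMagma = record
                { isEquivalence = record
                  { refl = λ _ → refl
                  ; sym = λ e i → sym (e i)
                  ; trans = λ e f i → trans (e i) (f i)
                  }
                ; ∙-cong = λ e f i → cong₂ ℚ._+_ (e i) (f i)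
                }
              ; assoc = λ x y z i → ℚ.+-assoc (seq x i) (seq y i) (seq z i)
              }
            ; identity = (λ x i → ℚ.+-identityˡ (seq x i)) , (λ x i → ℚ.+-identityʳ (seq x i))
            }
          ; comm = λ x y i → ℚ.+-comm (seq x i) (seq y i)
          }
        ; *-cong = λ e f i → cong₂ ℚ._*_ (e i) (f i)
        ; *-assoc = λ x y z i → ℚ.*-assoc (seq x i) (seq y i) (seq z i)
        ; *-identity = (λ x i → ℚ.*-identityˡ (seq x i)) , (λ x i → ℚ.*-identityʳ (seq x i))
        ; distrib = (λ x y z i → ℚ.*-distribˡ-+ (seq x i) (seq y i) (seq z i))
                  , (λ x y z i → ℚ.*-distribʳ-+ (seq x i) (seq y i) (seq z i))
        }
      ; zero = (λ x i → ℚ.*-zeroˡ (seq x i)) , (λ x i → ℚ.*-zeroʳ (seq x i))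
      }
    ; *-comm = λ x y i → ℚ.*-comm (seq x i) (seq y i)
    }
  }

module ℝSolver = SemiringSolver ℝ-commutativeSemiring

≤-slack : ∀ {p q ε} → 0ℚ ℚ.< ε → p ℚ.≤ q → p ℚ.≤ q ℚ.+ ε
≤-slack {p} {q} 0<ε h = subst (ℚ._≤ _) (ℚ.+-identityʳ p) (ℚ.+-mono-≤ h (ℚ.<⇒≤ 0<ε))

pointwise⇒≤ : (∀ i → seq x i ℚ.≤ seq y i) → x ≤ᴿ y
pointwise⇒≤ h ε 0<ε = 0 , λ i _ → ≤-slack 0<ε (h i)

≈⇒≤ : x ≈ y → x ≤ᴿ y
≈⇒≤ {x} {y} e = pointwise⇒≤ {x} {y} λ i → ℚ.≤-reflexive (e i)

≤ᴿ-refl : x ≤ᴿ x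
≤ᴿ-refl {x} = ≈⇒≤ {x} {x} λ _ → refl

≤ᴿ-trans : x ≤ᴿ y → y ≤ᴿ z → x ≤ᴿ z
≤ᴿ-trans {x} {y} {z} h₁ h₂ ε 0<ε with h₁ _ (half>0 0<ε) | h₂ _ (half>0 0<ε)
... | M , hM | N , hN = M ⊔ N , λ i i≥ → begin
    seq x i                            ≤⟨ hM i (m≤⊔ M N i≥) ⟩
    seq y i ℚ.+ ½ ℚ.* ε                ≤⟨ ℚ.+-monoˡ-≤ (½ ℚ.* ε) (hN i (n≤⊔ M N i≥)) ⟩
    (seq z i ℚ.+ ½ ℚ.* ε) ℚ.+ ½ ℚ.* ε  ≡⟨ ℚ.+-assoc (seq z i) (½ ℚ.* ε) (½ ℚ.* ε) ⟩
    seq z i ℚ.+ (½ ℚ.* ε ℚ.+ ½ ℚ.* ε)  ≡⟨ cong (seq z i ℚ.+_) (half+half ε) ⟩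
    seq z i ℚ.+ ε                      ∎
  where open ℚ.≤-Reasoning

+ᴿ-mono-≤ : x ≤ᴿ y → u ≤ᴿ v → x +ᴿ u ≤ᴿ y +ᴿ v
+ᴿ-mono-≤ {x} {y} {u} {v} h₁ h₂ ε 0<ε with h₁ _ (half>0 0<ε) | h₂ _ (half>0 0<ε)
... | M , hM | N , hN = M ⊔ N , λ i i≥ → begin
    seq x i ℚ.+ seq u i
      ≤⟨ ℚ.+-mono-≤ (hM i (m≤⊔ M N i≥)) (hN i (n≤⊔ M N i≥)) ⟩
    (seq y i ℚ.+ ½ ℚ.* ε) ℚ.+ (seq v i ℚ.+ ½ ℚ.* ε)
      ≡⟨ solve 3 (λ a b h → (a :+ h) :+ (b :+ h) := (a :+ b) :+ (h :+ h)) refl (seq y i) (seq v i) (½ ℚ.* ε) ⟩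
    (seq y i ℚ.+ seq v i) ℚ.+ (½ ℚ.* ε ℚ.+ ½ ℚ.* ε)
      ≡⟨ cong (seq y i ℚ.+ seq v i ℚ.+_) (half+half ε) ⟩
    (seq y i ℚ.+ seq v i) ℚ.+ ε  ∎
  where
  open ℚ.≤-Reasoning
  open ℚSolver.+-*-Solver

+ᴿ-cancelˡ-≤ : ∀ x → x +ᴿ y ≤ᴿ x +ᴿ z → y ≤ᴿ z
+ᴿ-cancelˡ-≤ {y} {z} x h ε 0<ε with h ε 0<ε
... | N , hN = N , λ i i≥ → subst₂ ℚ._≤_
    (solve 2 (λ a b → :- a :+ (a :+ b) := b) refl (seq x i) (seq y i))
    (solve 3 (λ a b e → :- a :+ (a :+ b :+ e) := b :+ e) refl (seq x i) (seq z i) ε)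
    (ℚ.+-monoʳ-≤ (ℚ.- seq x i) (hN i i≥))
  where open ℚSolver.+-*-Solver

-- Multiplying q ≤ r by p ≥ 0, when both hypotheses hold up to δ only: the error of
-- the conclusion is δ (p + r + δ - q), and A + B bounds the second factor.
*-mono-approx : ∀ {p q r δ A B ε} → 0ℚ ℚ.≤ δ → 0ℚ ℚ.≤ p ℚ.+ δ → q ℚ.≤ r ℚ.+ δ →
  p ℚ.+ r ℚ.+ δ ℚ.≤ A → ℚ.- q ℚ.≤ B → δ ℚ.* (A ℚ.+ B) ℚ.≤ ε →
  p ℚ.* q ℚ.≤ p ℚ.* r ℚ.+ ε
*-mono-approx {p} {q} {r} {δ} {A} {B} {ε} 0≤δ 0≤p h hA hB hε = begin
    p ℚ.* q
      ≡⟨ split ⟩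
    (p ℚ.+ δ) ℚ.* q ℚ.+ δ ℚ.* ℚ.- q
      ≤⟨ ℚ.+-monoˡ-≤ (δ ℚ.* ℚ.- q) (ℚ.*-monoˡ-≤-nonNeg (p ℚ.+ δ) {{ℚ.nonNegative 0≤p}} h) ⟩
    (p ℚ.+ δ) ℚ.* (r ℚ.+ δ) ℚ.+ δ ℚ.* ℚ.- q
      ≡⟨ regroup ⟩
    p ℚ.* r ℚ.+ δ ℚ.* (p ℚ.+ r ℚ.+ δ ℚ.- q)
      ≤⟨ ℚ.+-monoʳ-≤ (p ℚ.* r) (ℚ.*-monoˡ-≤-nonNeg δ {{ℚ.nonNegative 0≤δ}} (ℚ.+-mono-≤ hA hB)) ⟩
    p ℚ.* r ℚ.+ δ ℚ.* (A ℚ.+ B)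
      ≤⟨ ℚ.+-monoʳ-≤ (p ℚ.* r) hε ⟩
    p ℚ.* r ℚ.+ ε ∎
  where
  open ℚ.≤-Reasoning
  open ℚSolver.+-*-Solver
  split : p ℚ.* q ≡ (p ℚ.+ δ) ℚ.* q ℚ.+ δ ℚ.* ℚ.- q
  split = solve 3 (λ p q δ → p :* q := (p :+ δ) :* q :+ δ :* (:- q)) refl p q δ
  regroup : (p ℚ.+ δ) ℚ.* (r ℚ.+ δ) ℚ.+ δ ℚ.* ℚ.- q ≡ p ℚ.* r ℚ.+ δ ℚ.* (p ℚ.+ r ℚ.+ δ ℚ.- q)
  regroup = solve 4 (λ p q r δ → (p :+ δ) :* (r :+ δ) :+ δ :* (:- q) :=
                                 p :* r :+ δ :* (p :+ r :+ δ :- q)) refl p q r δ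

*ᴿ-monoˡ-≤ : ∀ x → 0ᴿ ≤ᴿ x → y ≤ᴿ z → x *ᴿ y ≤ᴿ x *ᴿ z
*ᴿ-monoˡ-≤ {y} {z} x 0≤x y≤z ε 0<ε =
  let a , K , hK = bounded x
      b , L , hL = bounded y
      c , M , hM = bounded z
      A = ι a ℚ.+ ι c ℚ.+ ι 1
      B = ι b
      d , hd = arch (a + c + 1 + b) ε 0<ε
      δ = 1/1+ d
      S , hS = 0≤x δ (1/1+>0 d)
      T , hT = y≤z δ (1/1+>0 d)
  in K ⊔ (L ⊔ (M ⊔ (S ⊔ T))) , λ i i≥ →
    let i≥L = n≤⊔ K _ i≥
        i≥M = n≤⊔ L _ i≥L
        i≥S = n≤⊔ M _ i≥M
    in *-mono-approx {seq x i} {seq y i} {seq z i} {δ} {A} {B}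
         (ℚ.<⇒≤ (1/1+>0 d))
         (hS i (m≤⊔ S T i≥S))
         (hT i (n≤⊔ S T i≥S))
         (ℚ.+-mono-≤ (ℚ.+-mono-≤ (ℚ.≤-trans (p≤∣p∣ (seq x i)) (hK i (m≤⊔ K _ i≥)))
                                 (ℚ.≤-trans (p≤∣p∣ (seq z i)) (hM i (m≤⊔ M _ i≥M))))
                     (1/1+-anti {0} {d} z≤n))
         (ℚ.≤-trans (p≤∣p∣ (ℚ.- seq y i))
           (subst (ℚ._≤ B) (sym (ℚ.∣-p∣≡∣p∣ (seq y i))) (hL i (m≤⊔ L _ i≥L))))
         (subst (ℚ._≤ ε)
           (trans (ℚ.*-comm (ι (a + c + 1 + b)) δ) (cong (δ ℚ.*_) (trans (ι-+ (a + c + 1) b)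
             (cong (ℚ._+ B) (trans (ι-+ (a + c) 1) (cong (ℚ._+ ι 1) (ι-+ a c)))))))
           hd)

*ᴿ-nonneg : 0ᴿ ≤ᴿ x → 0ᴿ ≤ᴿ y → 0ᴿ ≤ᴿ x *ᴿ y
*ᴿ-nonneg {x} {y} 0≤x 0≤y =
  ≤ᴿ-trans {0ᴿ} {x *ᴿ 0ᴿ} {x *ᴿ y} (≈⇒≤ {0ᴿ} {x *ᴿ 0ᴿ} λ i → sym (ℚ.*-zeroʳ (seq x i)))
    (*ᴿ-monoˡ-≤ {0ᴿ} {y} x 0≤x 0≤y)

fromℚ-mono-≤ : ∀ {p q} → p ℚ.≤ q → fromℚ p ≤ᴿ fromℚ q
fromℚ-mono-≤ {p} {q} h = pointwise⇒≤ {fromℚ p} {fromℚ q} λ _ → h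

fromℕ≥0 : ∀ n → 0ᴿ ≤ᴿ fromℕ n
fromℕ≥0 n = fromℚ-mono-≤ (ι≥0 n)

fromℕ-cancelˡ-≤ : ∀ n .{{_ : NonZero n}} → fromℕ n *ᴿ x ≤ᴿ fromℕ n *ᴿ y → x ≤ᴿ y
fromℕ-cancelˡ-≤ {x} {y} (suc n) h =
  ≤ᴿ-trans {x} {r *ᴿ (fromℕ (suc n) *ᴿ x)} {y}
    (≈⇒≤ {x} {r *ᴿ (fromℕ (suc n) *ᴿ x)} λ i → sym (undo (seq x i)))
    (≤ᴿ-trans {r *ᴿ (fromℕ (suc n) *ᴿ x)} {r *ᴿ (fromℕ (suc n) *ᴿ y)} {y}
      (*ᴿ-monoˡ-≤ {fromℕ (suc n) *ᴿ x} {fromℕ (suc n) *ᴿ y} r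
        (fromℚ-mono-≤ (ℚ.<⇒≤ (1/1+>0 n))) h)
      (≈⇒≤ {r *ᴿ (fromℕ (suc n) *ᴿ y)} {y} λ i → undo (seq y i)))
  where
  r = fromℚ (1/1+ n)
  undo : ∀ p → 1/1+ n ℚ.* (ι (suc n) ℚ.* p) ≡ p
  undo p = begin
    1/1+ n ℚ.* (ι (suc n) ℚ.* p) ≡⟨ ℚ.*-assoc (1/1+ n) (ι (suc n)) p ⟨
    1/1+ n ℚ.* ι (suc n) ℚ.* p   ≡⟨ cong (ℚ._* p) (trans (ℚ.*-comm (1/1+ n) (ι (suc n))) (ι-inv n)) ⟩
    1ℚ ℚ.* p                     ≡⟨ ℚ.*-identityˡ p ⟩
    p                            ∎
    where open ≡-Reasoning

≤ᴿ-preorder : Preorder 0ℓ 0ℓ 0ℓ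
≤ᴿ-preorder = record
  { Carrier = ℝ
  ; _≈_ = _≈_
  ; _≲_ = _≤ᴿ_
  ; isPreorder = record
    { isEquivalence = CS.isEquivalence
    ; reflexive = λ {x} {y} → ≈⇒≤ {x} {y}
    ; trans = λ {x} {y} {z} → ≤ᴿ-trans {x} {y} {z}
    }
  }
  where module CS = CommutativeSemiring ℝ-commutativeSemiring

module ≤ᴿ-Reasoning = PreorderReasoning ≤ᴿ-preorder

fromℕ-mono-≤ : ∀ {m n} → m ≤ n → fromℕ m ≤ᴿ fromℕ n
fromℕ-mono-≤ h = fromℚ-mono-≤ (ι-mono h)

------------------------------------------------------------------------
-- Real powers of naturals

-- If T/I ≤ n^a and s^a ≤ U/I for a = (p-m)/q ≤ k + 1/D, where 1 ≤ s ≤ n, then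
-- T/U ≤ (n/s)^a ≤ (n/s)^k n^(1/D) ≤ (n/s)^k (1 + n/D). Denominators are cleared.
ratio-bound : ∀ n s .{{_ : NonZero n}} .{{_ : NonZero s}} → s ≤ n →
  ∀ {T U p m} k q I D .{{_ : NonZero q}} .{{_ : NonZero I}} .{{_ : NonZero D}} →
  T ^ q * n ^ m ≤ I ^ q * n ^ p →
  I ^ q * s ^ p ≤ U ^ q * s ^ m →
  p * D ≤ m * D + k * (q * D) + q →
  T * s ^ k * D ≤ U * n ^ k * (D + n)
ratio-bound n s s≤n {T} {U} {p} {m} k q I D h₁ h₂ h₃ = ^-cancelʳ-≤ Q (begin
    (T * s ^ k * D) ^ Q
      ≡⟨ pow₃ T s D ⟩
    T ^ Q * s ^ K * D ^ Q
      ≤⟨ ℕ.*-monoˡ-≤ (D ^ Q) (ℕ.*-monoʳ-≤ (T ^ Q) (ℕ.^-monoʳ-≤ s (ℕ.m≤m+n K q))) ⟩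
    T ^ Q * s ^ (K + q) * D ^ Q
      ≤⟨ ℕ.*-monoˡ-≤ (D ^ Q) cancelled ⟩
    U ^ Q * n ^ (K + q) * D ^ Q
      ≡⟨ cong (λ x → U ^ Q * x * D ^ Q) (ℕ.^-distribˡ-+-* n K q) ⟩
    U ^ Q * (n ^ K * n ^ q) * D ^ Q
      ≡⟨ solve 4 (λ u x y d → u :* (x :* y) :* d := u :* x :* (d :* y)) refl (U ^ Q) (n ^ K) (n ^ q) (D ^ Q) ⟩
    U ^ Q * n ^ K * (D ^ Q * n ^ q)
      ≤⟨ ℕ.*-monoʳ-≤ (U ^ Q * n ^ K) root ⟩
    U ^ Q * n ^ K * (D + n) ^ Q
      ≡⟨ pow₃ U n (D + n) ⟨
    (U * n ^ k * (D + n)) ^ Q ∎)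
  where
  open ℕSolver.+-*-Solver
  open ℕ.≤-Reasoning
  Q = q * D
  K = k * Q
  instance
    Q≢0 : NonZero Q
    Q≢0 = ℕ.m*n≢0 q D
  pow₃ : ∀ x y z → (x * y ^ k * z) ^ Q ≡ x ^ Q * y ^ K * z ^ Q
  pow₃ x y z = trans (^-distribʳ-* (x * y ^ k) z Q)
    (cong (_* z ^ Q) (trans (^-distribʳ-* x (y ^ k) Q) (cong (x ^ Q *_) (ℕ.^-*-assoc y k Q))))
  root : D ^ Q * n ^ q ≤ (D + n) ^ Q
  root = subst₂ _≤_ (trans (^-distribʳ-* (D ^ D) n q) (cong (_* n ^ q) (exp D))) (exp (D + n))
    (ℕ.^-monoˡ-≤ q (root-bound D n))
    where
    exp : ∀ x → (x ^ D) ^ q ≡ x ^ Q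
    exp x = trans (ℕ.^-*-assoc x D q) (cong (x ^_) (ℕ.*-comm D q))
  combined : T ^ q * n ^ m * s ^ p ≤ U ^ q * s ^ m * n ^ p
  combined = ℕ.*-cancelˡ-≤ (I ^ q) {{ℕ.m^n≢0 I q}} (begin
    I ^ q * (T ^ q * n ^ m * s ^ p)
      ≡⟨ solve 3 (λ i x y → i :* (x :* y) := x :* (i :* y)) refl (I ^ q) (T ^ q * n ^ m) (s ^ p) ⟩
    T ^ q * n ^ m * (I ^ q * s ^ p)
      ≤⟨ ℕ.*-mono-≤ h₁ h₂ ⟩
    I ^ q * n ^ p * (U ^ q * s ^ m)
      ≡⟨ solve 3 (λ i x y → i :* x :* y := i :* (y :* x)) refl (I ^ q) (n ^ p) (U ^ q * s ^ m) ⟩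
    I ^ q * (U ^ q * s ^ m * n ^ p) ∎)
  pow : ∀ x y z e f → (x ^ q * y ^ e * z ^ f) ^ D ≡ x ^ Q * y ^ (e * D) * z ^ (f * D)
  pow x y z e f = trans (^-distribʳ-* (x ^ q * y ^ e) (z ^ f) D)
    (cong₂ _*_ (trans (^-distribʳ-* (x ^ q) (y ^ e) D)
                 (cong₂ _*_ (ℕ.^-*-assoc x q D) (ℕ.^-*-assoc y e D))) (ℕ.^-*-assoc z f D))
  raised : T ^ Q * n ^ (m * D) * s ^ (p * D) ≤ U ^ Q * s ^ (m * D) * n ^ (p * D)
  raised = subst₂ _≤_ (pow T n s m p) (pow U s n m p) (ℕ.^-monoˡ-≤ D combined)
  M = m * D
  X = (m * D + k * (q * D) + q) ∸ p * D
  pad : ∀ x → x ^ (p * D) * x ^ X ≡ x ^ M * x ^ (K + q)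
  pad x = trans (sym (ℕ.^-distribˡ-+-* x (p * D) X))
    (trans (cong (x ^_) (trans (ℕ.m+[n∸m]≡n h₃) (ℕ.+-assoc M K q))) (ℕ.^-distribˡ-+-* x M (K + q)))
  -- X is the slack in the bound on the exponent. Multiplying by s^X ≤ n^X gives
  -- both sides the common factor n^M s^M.
  cancelled : T ^ Q * s ^ (K + q) ≤ U ^ Q * n ^ (K + q)
  cancelled = ℕ.*-cancelʳ-≤ _ _ (n ^ M * s ^ M) {{ℕ.m*n≢0 (n ^ M) (s ^ M) {{ℕ.m^n≢0 n M}} {{ℕ.m^n≢0 s M}}}} (begin
    T ^ Q * s ^ (K + q) * (n ^ M * s ^ M)
      ≡⟨ solve 4 (λ t x y z → t :* x :* (y :* z) := t :* y :* (z :* x))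
           refl (T ^ Q) (s ^ (K + q)) (n ^ M) (s ^ M) ⟩
    T ^ Q * n ^ M * (s ^ M * s ^ (K + q))
      ≡⟨ cong (T ^ Q * n ^ M *_) (pad s) ⟨
    T ^ Q * n ^ M * (s ^ (p * D) * s ^ X)
      ≡⟨ ℕ.*-assoc (T ^ Q * n ^ M) (s ^ (p * D)) (s ^ X) ⟨
    T ^ Q * n ^ M * s ^ (p * D) * s ^ X
      ≤⟨ ℕ.*-mono-≤ raised (ℕ.^-monoˡ-≤ X s≤n) ⟩
    U ^ Q * s ^ M * n ^ (p * D) * n ^ X
      ≡⟨ ℕ.*-assoc (U ^ Q * s ^ M) (n ^ (p * D)) (n ^ X) ⟩
    U ^ Q * s ^ M * (n ^ (p * D) * n ^ X)
      ≡⟨ cong (U ^ Q * s ^ M *_) (pad n) ⟩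
    U ^ Q * s ^ M * (n ^ M * n ^ (K + q))
      ≡⟨ solve 4 (λ t x y z → t :* z :* (y :* x) := t :* x :* (y :* z))
           refl (U ^ Q) (n ^ (K + q)) (n ^ M) (s ^ M) ⟩
    U ^ Q * n ^ (K + q) * (n ^ M * s ^ M) ∎)

-- The inequality a ≤ k + 1/(d+1) in terms of the numerator and denominator of a.
exponent-bound : ∀ a k d → a ℚ.≤ ι k ℚ.+ 1/1+ d →
  posPart (ℚ.↥ a) * suc d ≤ negPart (ℚ.↥ a) * suc d + k * (ℚ.↧ₙ a * suc d) + ℚ.↧ₙ a
exponent-bound a k d h = subst₂ _≤_
    (solve 3 (λ p q d → p :* (con 1 :* d) :+ con 0 := p :* d) refl (posPart (ℚ.↥ a)) (ℚ.↧ₙ a) (suc d))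
    (solve 4 (λ m k q d → m :* (con 1 :* d) :+ k :* (q :* d) :+ q :* con 1 := m :* d :+ k :* (q :* d) :+ q)
      refl (negPart (ℚ.↥ a)) k (ℚ.↧ₙ a) (suc d))
    (exponents a b d (subst (λ x → a ℚ.≤ x ℚ.+ 1/1+ d) (ℚ.↥p/↧p≡p b) h))
  where
  open ℕSolver.+-*-Solver
  b = ℚ.mkℚ (+ k) 0 (coprime-sym (1-coprimeTo k))

^ᴿ≥0 : ∀ m α → 0ᴿ ≤ᴿ m ^ᴿ α
^ᴿ≥0 zero      α = ≤ᴿ-refl {0ᴿ}
^ᴿ≥0 m@(suc _) α = pointwise⇒≤ {0ᴿ} {m ^ᴿ α} λ i → /-mono 0 0 ⌊ suc i · m ^ seq α i ⌋ i z≤n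

-- The inequality n^α c ≤ N s^α of i-th approximations, where α_i ≤ k + 1/(d+1).
-- The error term 1/(i+1) accounts for rounding down in the approximation of s^α, and
-- n/(d+1) for the excess of α_i over k.
pow-ratio-approx : ∀ n s .{{_ : NonZero n}} .{{_ : NonZero s}} → s ≤ n →
  ∀ {c N} k → c * n ^ k ≤ N * s ^ k → ∀ α i d → seq α i ℚ.≤ ι k ℚ.+ 1/1+ d →
  powSeq n α i ℚ.* ι c ℚ.≤ ι N ℚ.* ((powSeq s α i ℚ.+ 1/1+ i) ℚ.* (1ℚ ℚ.+ ι n ℚ.* 1/1+ d))
pow-ratio-approx n s s≤n {c} {N} k cn≤Ns α i d h = subst₂ ℚ._≤_ lhs rhs
    (/-mono (T * c) (i * 1) (N * (U * (D + n))) (d + i * D + 0) (begin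
      T * c * (1 * (I * D))
        ≡⟨ solve 4 (λ t c i d → t :* c :* (con 1 :* (i :* d)) := t :* c :* d :* i) refl T c I D ⟩
      T * c * D * I              ≤⟨ ℕ.*-monoˡ-≤ I integral ⟩
      N * (U * (D + n)) * I      ≡⟨ cong (N * (U * (D + n)) *_) (ℕ.*-identityʳ I) ⟨
      N * (U * (D + n)) * (I * 1) ∎))
  where
  open ℕ.≤-Reasoning
  open ℕSolver.+-*-Solver
  I = suc i
  D = suc d
  T = ⌊ I · n ^ seq α i ⌋
  t = ⌊ I · s ^ seq α i ⌋
  U = suc t
  bound : T * s ^ k * D ≤ U * n ^ k * (D + n)
  bound = ratio-bound n s s≤n {T} {U} {posPart (ℚ.↥ seq α i)} {negPart (ℚ.↥ seq α i)} k (ℚ.↧ₙ seq α i) I D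
    (⌊⌋-below n (seq α i) I) (ℕ.<⇒≤ (⌊⌋-above s (seq α i) I)) (exponent-bound (seq α i) k d h)
  integral : T * c * D ≤ N * (U * (D + n))
  integral = ℕ.*-cancelʳ-≤ _ _ (n ^ k) {{ℕ.m^n≢0 n k}} (begin
    T * c * D * n ^ k
      ≡⟨ solve 4 (λ t c d x → t :* c :* d :* x := t :* d :* (c :* x)) refl T c D (n ^ k) ⟩
    T * D * (c * n ^ k)        ≤⟨ ℕ.*-monoʳ-≤ (T * D) cn≤Ns ⟩
    T * D * (N * s ^ k)
      ≡⟨ solve 4 (λ t d n x → t :* d :* (n :* x) := n :* (t :* x :* d)) refl T D N (s ^ k) ⟩
    N * (T * s ^ k * D)        ≤⟨ ℕ.*-monoʳ-≤ N bound ⟩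
    N * (U * n ^ k * (D + n))
      ≡⟨ solve 4 (λ n u x y → n :* (u :* x :* y) := n :* (u :* y) :* x) refl N U (n ^ k) (D + n) ⟩
    N * (U * (D + n)) * n ^ k  ∎)
  lhs : + (T * c) ℚ./ (I * 1) ≡ powSeq n α i ℚ.* ι c
  lhs = sym (/-* T i c 0)
  u≡ : + U ℚ./ I ≡ powSeq s α i ℚ.+ 1/1+ i
  u≡ = trans (frac≡ U i) (trans (cong (ℚ._* 1/1+ i) (ι-+ 1 t))
    (trans (ℚ.*-distribʳ-+ (1/1+ i) 1ℚ (ι t)) (trans (ℚ.+-comm (1ℚ ℚ.* 1/1+ i) _)
      (cong₂ ℚ._+_ (sym (frac≡ t i)) (ℚ.*-identityˡ (1/1+ i))))))
  D≡ : + (D + n) ℚ./ D ≡ 1ℚ ℚ.+ ι n ℚ.* 1/1+ d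
  D≡ = trans (frac≡ (D + n) d) (trans (cong (ℚ._* 1/1+ d) (ι-+ D n))
    (trans (ℚ.*-distribʳ-+ (1/1+ d) (ι D) (ι n)) (cong (ℚ._+ ι n ℚ.* 1/1+ d) (ι-inv d))))
  rhs : + (N * (U * (D + n))) ℚ./ (1 * (I * D)) ≡ ι N ℚ.* ((powSeq s α i ℚ.+ 1/1+ i) ℚ.* (1ℚ ℚ.+ ι n ℚ.* 1/1+ d))
  rhs = trans (sym (/-* N 0 (U * (D + n)) (d + i * D)))
    (cong (ι N ℚ.*_) (trans (sym (/-* U i (D + n) d)) (cong₂ ℚ._*_ u≡ D≡)))

-- An additive error r and a relative error nδ in p change N p by at most ε in total.
absorb-error : ∀ {N p r B n δ ε} → 0ℚ ℚ.≤ N → 0ℚ ℚ.≤ n ℚ.* δ → p ℚ.+ r ℚ.≤ B →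
  N ℚ.* r ℚ.≤ ½ ℚ.* ε → N ℚ.* B ℚ.* n ℚ.* δ ℚ.≤ ½ ℚ.* ε →
  N ℚ.* ((p ℚ.+ r) ℚ.* (1ℚ ℚ.+ n ℚ.* δ)) ℚ.≤ N ℚ.* p ℚ.+ ε
absorb-error {N} {p} {r} {B} {n} {δ} {ε} 0≤N 0≤nδ hB h₁ h₂ = begin
    N ℚ.* ((p ℚ.+ r) ℚ.* (1ℚ ℚ.+ n ℚ.* δ))
      ≡⟨ solve 4 (λ N p r s → N :* ((p :+ r) :* (con 1ℚ :+ s)) := N :* p :+ (N :* r :+ N :* ((p :+ r) :* s)))
           refl N p r (n ℚ.* δ) ⟩
    N ℚ.* p ℚ.+ (N ℚ.* r ℚ.+ N ℚ.* ((p ℚ.+ r) ℚ.* (n ℚ.* δ)))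
      ≤⟨ ℚ.+-monoʳ-≤ (N ℚ.* p) (ℚ.+-mono-≤ h₁ (ℚ.≤-trans
           (ℚ.*-monoˡ-≤-nonNeg N {{ℚ.nonNegative 0≤N}}
             (ℚ.*-monoʳ-≤-nonNeg (n ℚ.* δ) {{ℚ.nonNegative 0≤nδ}} hB))
           (subst (ℚ._≤ ½ ℚ.* ε) (solve 4 (λ N B n δ → N :* B :* n :* δ := N :* (B :* (n :* δ)))
                refl N B n δ) h₂))) ⟩
    N ℚ.* p ℚ.+ (½ ℚ.* ε ℚ.+ ½ ℚ.* ε)
      ≡⟨ cong (N ℚ.* p ℚ.+_) (half+half ε) ⟩
    N ℚ.* p ℚ.+ ε ∎
  where
  open ℚ.≤-Reasoning
  open ℚSolver.+-*-Solver

-- If c/N ≤ (s/n)^k then c/N ≤ (s/n)^α, because s ≤ n and α ≤ k.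
pow-ratio : ∀ n s .{{_ : NonZero n}} .{{_ : NonZero s}} → s ≤ n →
  ∀ {c N} k → c * n ^ k ≤ N * s ^ k → ∀ α → α ≤ᴿ fromℕ k →
  n ^ᴿ α *ᴿ fromℕ c ≤ᴿ fromℕ N *ᴿ s ^ᴿ α
pow-ratio n@(suc _) s@(suc _) s≤n {c} {N} k cn≤Ns α α≤k ε 0<ε =
  let b , K , hK = bounded (s ^ᴿ α)
      d , hd = arch (N * (b + 1) * n) (½ ℚ.* ε) (half>0 0<ε)
      e , he = arch N (½ ℚ.* ε) (half>0 0<ε)
      L , hL = α≤k (1/1+ d) (1/1+>0 d)
      0≤nδ = subst (0ℚ ℚ.≤_) (frac≡ n d) (/-mono 0 0 n d z≤n)
  in K ⊔ (L ⊔ e) , λ i i≥ → ℚ.≤-trans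
    (pow-ratio-approx n s s≤n {c} {N} k cn≤Ns α i d (hL i (m≤⊔ L e (n≤⊔ K _ i≥))))
    (absorb-error {ι N} {powSeq s α i} {1/1+ i} {ι b ℚ.+ ι 1} {ι n} {1/1+ d} (ι≥0 N) 0≤nδ
      (ℚ.+-mono-≤ (ℚ.≤-trans (p≤∣p∣ (powSeq s α i)) (hK i (m≤⊔ K _ i≥))) (1/1+-anti {0} {i} z≤n))
      (ℚ.≤-trans (ℚ.*-monoˡ-≤-nonNeg (ι N) {{ℚ.nonNegative (ι≥0 N)}} (1/1+-anti {e} {i} (n≤⊔ L e (n≤⊔ K _ i≥)))) he)
      (subst (ℚ._≤ ½ ℚ.* ε) (cong (ℚ._* 1/1+ d) (trans (ι-* (N * (b + 1)) n)
        (cong (ℚ._* ι n) (trans (ι-* N (b + 1)) (cong (ι N ℚ.*_) (ι-+ b 1)))))) hd))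

------------------------------------------------------------------------
-- Weighted sums

partialSum-≤-extend : ∀ f → (∀ j → 0ᴿ ≤ᴿ f j) → ∀ {M N} → M ≤ N → partialSum f M ≤ᴿ partialSum f N
partialSum-≤-extend f f≥0 {M} {N} M≤N =
  subst (λ L → partialSum f M ≤ᴿ partialSum f L) (ℕ.m∸n+n≡m M≤N) (go (N ∸ M))
  where
  go : ∀ d → partialSum f M ≤ᴿ partialSum f (d + M)
  go zero    = ≤ᴿ-refl {partialSum f M}
  go (suc d) = begin
      partialSum f M                    ≈⟨ (λ i → ℚ.+-identityʳ _) ⟨
      partialSum f M +ᴿ 0ᴿ
        ≲⟨ +ᴿ-mono-≤ {partialSum f M} {partialSum f (d + M)} {0ᴿ} {f (d + M)} (go d) (f≥0 (d + M)) ⟩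
      partialSum f (d + M) +ᴿ f (d + M) ∎
    where open ≤ᴿ-Reasoning

fromℕ-count : {P : A → Set} (P? : ∀ a → Dec (P a)) → ∀ a as →
  fromℕ (count P? (a ∷ as)) ≈ indicator (P? a) +ᴿ fromℕ (count P? as)
fromℕ-count P? a as i with does (P? a)
... | true  = ι-+ 1 (count P? as)
... | false = sym (ℚ.+-identityˡ (ι (count P? as)))

*ᴿ-fromℕ-suc : ∀ c m → c *ᴿ fromℕ (suc m) ≈ c +ᴿ c *ᴿ fromℕ m
*ᴿ-fromℕ-suc c m i = begin
    seq c i ℚ.* ι (suc m)               ≡⟨ cong (seq c i ℚ.*_) (ι-+ 1 m) ⟩
    seq c i ℚ.* (1ℚ ℚ.+ ι m)            ≡⟨ ℚ.*-distribˡ-+ (seq c i) 1ℚ (ι m) ⟩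
    seq c i ℚ.* 1ℚ ℚ.+ seq c i ℚ.* ι m  ≡⟨ cong (ℚ._+ seq c i ℚ.* ι m) (ℚ.*-identityʳ (seq c i)) ⟩
    seq c i ℚ.+ seq c i ℚ.* ι m         ∎
  where open ≡-Reasoning

indicator≥0 : {P : Set} (P? : Dec P) → 0ᴿ ≤ᴿ indicator P?
indicator≥0 P? with does P?
... | true  = fromℕ≥0 1
... | false = ≤ᴿ-refl {0ᴿ}

-- Finitely many series of nonnegative terms whose partial sums reach c do so at a
-- common stage.
common-stage : (f : A → ℕ → ℝ) → (∀ a j → 0ᴿ ≤ᴿ f a j) → (c : ℝ) →
  (∀ a → ∃[ M ] c ≤ᴿ partialSum (f a) M) → ∀ as → ∃[ M ] All (λ a → c ≤ᴿ partialSum (f a) M) as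
common-stage f f≥0 c h []       = 0 , []
common-stage f f≥0 c h (a ∷ as) with h a | common-stage f f≥0 c h as
... | M , hM | N , hN = M ⊔ N
  , ≤ᴿ-trans {c} {partialSum (f a) M} {partialSum (f a) (M ⊔ N)} hM
      (partialSum-≤-extend (f a) (f≥0 a) (ℕ.m≤m⊔n M N))
  ∷ All.map (λ {b} hb → ≤ᴿ-trans {c} {partialSum (f b) N} {partialSum (f b) (M ⊔ N)} hb
      (partialSum-≤-extend (f b) (f≥0 b) (ℕ.m≤n⊔m M N))) hN

-- The supremum need not be attained, but some partial sum falls short of 9/10 by at
-- most 1/10, which is written 1/1+ 9.
≤Σ∞⇒stage : ∀ f → fromℚ (+ 9 / 10) ≤Σ∞ f → ∃[ M ] fromℚ (+ 8 / 10) ≤ᴿ partialSum f M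
≤Σ∞⇒stage f h with h (1/1+ 9) (1/1+>0 9)
... | M , hM = M , +ᴿ-cancelˡ-≤ {fromℚ (+ 8 / 10)} {partialSum f M} (fromℚ (1/1+ 9)) (begin
    fromℚ (1/1+ 9) +ᴿ fromℚ (+ 8 / 10)       ≈⟨ (λ _ → refl) ⟩
    fromℚ (+ 9 / 10)                          ≲⟨ hM ⟩
    partialSum f M +ᴿ fromℚ (1/1+ 9)          ≈⟨ (λ i → ℚ.+-comm (seq (partialSum f M) i) (1/1+ 9)) ⟩
    fromℚ (1/1+ 9) +ᴿ partialSum f M          ∎)
  where open ≤ᴿ-Reasoning

module _ {P : A → ℕ → Set} (P? : ∀ a j → Dec (P a j)) (w : ℕ → ℝ) where

  -- The contribution of outcome j to the probability of P a.
  weight : A → ℕ → ℝ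
  weight a j = w j *ᴿ indicator (P? a j)

  -- If each event has probability at least c among the first M outcomes, then m, the
  -- number of events that occur, has expectation at least c times their number.
  expected-count : ∀ c M as (m : ℕ → ℕ) → (∀ j → m j ≡ count (λ a → P? a j) as) →
    All (λ a → c ≤ᴿ partialSum (weight a) M) as →
    c *ᴿ fromℕ (length as) ≤ᴿ partialSum (λ j → w j *ᴿ fromℕ (m j)) M
  expected-count c M [] m m≡ [] = begin
      c *ᴿ fromℕ 0                             ≈⟨ (λ i → ℚ.*-zeroʳ (seq c i)) ⟩
      0ᴿ                                       ≈⟨ vanish M ⟩
      partialSum (λ j → w j *ᴿ fromℕ (m j)) M  ∎
    where
    open ≤ᴿ-Reasoning
    vanish : ∀ M → 0ᴿ ≈ partialSum (λ j → w j *ᴿ fromℕ (m j)) M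
    vanish zero    i = refl
    vanish (suc M) i = cong₂ ℚ._+_ (vanish M i)
      (sym (trans (cong (λ m → seq (w M) i ℚ.* ι m) (m≡ M)) (ℚ.*-zeroʳ (seq (w M) i))))
  expected-count c M (a ∷ as) m m≡ (h ∷ hs) = begin
      c *ᴿ fromℕ (suc (length as))             ≈⟨ *ᴿ-fromℕ-suc c (length as) ⟩
      c +ᴿ c *ᴿ fromℕ (length as)
        ≲⟨ +ᴿ-mono-≤ {c} {partialSum (weight a) M} {c *ᴿ fromℕ (length as)} {partialSum rest M}
             h (expected-count c M as (λ j → count (λ a → P? a j) as) (λ _ → refl) hs) ⟩
      partialSum (weight a) M +ᴿ partialSum rest M
        ≈⟨ merge M ⟩
      partialSum (λ j → w j *ᴿ fromℕ (m j)) M  ∎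
    where
    open ≤ᴿ-Reasoning
    open ℝSolver using (_:+_; _:*_; _:=_)
    rest : ℕ → ℝ
    rest j = w j *ᴿ fromℕ (count (λ a → P? a j) as)
    merge : ∀ M → partialSum (weight a) M +ᴿ partialSum rest M ≈ partialSum (λ j → w j *ᴿ fromℕ (m j)) M
    merge zero    i = refl
    merge (suc M) i = trans
      (ℝSolver.solve 5 (λ s t w x y → (s :+ w :* x) :+ (t :+ w :* y) := (s :+ t) :+ w :* (x :+ y))
        (λ _ → refl) (partialSum (weight a) M) (partialSum rest M) (w M)
        (indicator (P? a M)) (fromℕ (count (λ a → P? a M) as)) i)
      (cong₂ ℚ._+_ (merge M i) (cong (seq (w M) i ℚ.*_)
        (sym (trans (cong ι (m≡ M)) (fromℕ-count (λ a → P? a M) a as i)))))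

  -- If each event has probability at least 9/10, then finitely many outcomes suffice for
  -- the preceding bound with c = 8/10.
  likely-count : (∀ j → 0ᴿ ≤ᴿ w j) → (∀ a → fromℚ (+ 9 / 10) ≤Σ∞ weight a) →
    ∀ as (m : ℕ → ℕ) → (∀ j → m j ≡ count (λ a → P? a j) as) →
    ∃[ M ] fromℚ (+ 8 / 10) *ᴿ fromℕ (length as) ≤ᴿ partialSum (λ j → w j *ᴿ fromℕ (m j)) M
  likely-count w≥0 likely as m m≡ =
    let M , hM = common-stage weight
          (λ a j → *ᴿ-nonneg {w j} {indicator (P? a j)} (w≥0 j) (indicator≥0 (P? a j)))
          (fromℚ (+ 8 / 10)) (λ a → ≤Σ∞⇒stage (weight a) (likely a)) as
    in M , expected-count (fromℚ (+ 8 / 10)) M as m m≡ hM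

-- The sum of the inequalities R a ≤ N (R + c) with nonnegative weights w.
weighted-sum-≤ : ∀ (R N : ℝ) (w a c : ℕ → ℝ) → (∀ j → 0ᴿ ≤ᴿ w j) →
  (∀ j → R *ᴿ a j ≤ᴿ N *ᴿ (R +ᴿ c j)) → ∀ M →
  R *ᴿ partialSum (λ j → w j *ᴿ a j) M ≤ᴿ N *ᴿ (R *ᴿ partialSum w M +ᴿ partialSum (λ j → w j *ᴿ c j) M)
weighted-sum-≤ R N w a c w≥0 h zero    = ≈⇒≤ {R *ᴿ 0ᴿ} {N *ᴿ (R *ᴿ 0ᴿ +ᴿ 0ᴿ)}
  (ℝSolver.solve 2 (λ R N → R :* con 0 := N :* (R :* con 0 :+ con 0)) (λ _ → refl) R N)
  where open ℝSolver using (_:+_; _:*_; _:=_; con)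
weighted-sum-≤ R N w a c w≥0 h (suc M) = begin
    R *ᴿ (Sa +ᴿ w M *ᴿ a M)
      ≈⟨ ℝSolver.solve 4 (λ R Sa w a → R :* (Sa :+ w :* a) := R :* Sa :+ w :* (R :* a))
           (λ _ → refl) R Sa (w M) (a M) ⟩
    R *ᴿ Sa +ᴿ w M *ᴿ (R *ᴿ a M)
      ≲⟨ +ᴿ-mono-≤ {R *ᴿ Sa} {N *ᴿ (R *ᴿ Sw +ᴿ Sc)} {w M *ᴿ (R *ᴿ a M)} {w M *ᴿ (N *ᴿ (R +ᴿ c M))}
           (weighted-sum-≤ R N w a c w≥0 h M)
           (*ᴿ-monoˡ-≤ {R *ᴿ a M} {N *ᴿ (R +ᴿ c M)} (w M) (w≥0 M) (h M)) ⟩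
    N *ᴿ (R *ᴿ Sw +ᴿ Sc) +ᴿ w M *ᴿ (N *ᴿ (R +ᴿ c M))
      ≈⟨ ℝSolver.solve 6 (λ R N Sw Sc w c → N :* (R :* Sw :+ Sc) :+ w :* (N :* (R :+ c)) :=
                                            N :* (R :* (Sw :+ w) :+ (Sc :+ w :* c)))
           (λ _ → refl) R N Sw Sc (w M) (c M) ⟩
    N *ᴿ (R *ᴿ (Sw +ᴿ w M) +ᴿ (Sc +ᴿ w M *ᴿ c M)) ∎
  where
  open ≤ᴿ-Reasoning
  open ℝSolver using (_:+_; _:*_; _:=_)
  Sa = partialSum (λ j → w j *ᴿ a j) M
  Sw = partialSum w M
  Sc = partialSum (λ j → w j *ᴿ c j) M

-- The same sum, for weights of total at most 1 that give c a weighted sum of at most C.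
average-≤ : ∀ (R : ℝ) (N : ℕ) (C : ℝ) (w a c : ℕ → ℝ) M → 0ᴿ ≤ᴿ R → (∀ j → 0ᴿ ≤ᴿ w j) →
  (∀ j → R *ᴿ a j ≤ᴿ fromℕ N *ᴿ (R +ᴿ c j)) →
  partialSum w M ≤ᴿ 1ᴿ → partialSum (λ j → w j *ᴿ c j) M ≤ᴿ C →
  R *ᴿ partialSum (λ j → w j *ᴿ a j) M ≤ᴿ fromℕ N *ᴿ (R +ᴿ C)
average-≤ R N C w a c M 0≤R w≥0 h total≤1 Sc≤C = begin
    R *ᴿ partialSum (λ j → w j *ᴿ a j) M
      ≲⟨ weighted-sum-≤ R (fromℕ N) w a c w≥0 h M ⟩
    fromℕ N *ᴿ (R *ᴿ Sw +ᴿ Sc)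
      ≲⟨ *ᴿ-monoˡ-≤ {R *ᴿ Sw +ᴿ Sc} {R *ᴿ 1ᴿ +ᴿ C} (fromℕ N) (fromℕ≥0 N)
           (+ᴿ-mono-≤ {R *ᴿ Sw} {R *ᴿ 1ᴿ} {Sc} {C} (*ᴿ-monoˡ-≤ {Sw} {1ᴿ} R 0≤R total≤1) Sc≤C) ⟩
    fromℕ N *ᴿ (R *ᴿ 1ᴿ +ᴿ C)
      ≈⟨ (λ i → cong (λ x → ι N ℚ.* (x ℚ.+ seq C i)) (ℚ.*-identityʳ (seq R i))) ⟩
    fromℕ N *ᴿ (R +ᴿ C) ∎
  where
  open ≤ᴿ-Reasoning
  Sw = partialSum w M
  Sc = partialSum (λ j → w j *ᴿ c j) M

------------------------------------------------------------------------
-- Deterministic algorithms on the test inputs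

cost≥0 : ∀ α m → 0ᴿ ≤ᴿ cost α m
cost≥0 α zero      = ≤ᴿ-refl {0ᴿ}
cost≥0 α m@(suc _) = ^ᴿ≥0 m α

oracleCost≥0 : ∀ {n k} α (t : DecisionTree n k) O → 0ᴿ ≤ᴿ oracleCost α t O
oracleCost≥0 α (output r)  O = ≤ᴿ-refl {0ᴿ}
oracleCost≥0 α (query q t) O = +ᴿ-mono-≤ {0ᴿ} {cost α (querySize q)} {0ᴿ} {oracleCost α (t (O q)) O}
  (cost≥0 α (querySize q)) (oracleCost≥0 α (t (O q)) O)

module _ {n k : ℕ} where

  edgeless : Hypergraph n k
  edgeless = record { edges = [] ; unique = [] ; uniform = [] }

  singleEdge : KSubset n k → Hypergraph n k
  singleEdge (e , ∣e∣) = record { edges = e ∷ [] ; unique = [] ∷ [] ; uniform = ∣e∣ ∷ [] }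

  cIND-singleEdge : ∀ q (e : KSubset n k) → ¬ Rainbow q (proj₁ e) → cIND (singleEdge e) q ≡ true
  cIND-singleEdge q (e , _) ¬r = cong not (dec-false (any? (rainbow? q) (e ∷ [])) λ { (here r) → ¬r r })

-- The number of the given hypergraphs on which a deterministic algorithm is correct.
correctOn : List (Hypergraph n k) → DetAlg → ℕ
correctOn 𝒢 A = count (λ G → correct? G A) 𝒢

module _ (n k : ℕ) where

  private
    N = n choose k

  -- Whether the tree reports an edge on the hypergraph with single edge e.
  found? : ∀ (t : DecisionTree n k) (e : KSubset n k) → Dec (run t (cIND (singleEdge e)) ≡ 1)
  found? t e = run t (cIND (singleEdge e)) ℕ.≟ 1

  -- The edgeless hypergraph N times, and each of the N hypergraphs with one edge.
  -- A constant answer is correct on exactly half of these.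
  testInputs : List (Hypergraph n k)
  testInputs = replicate N edgeless ++ map singleEdge (kSubsets n k)

  length-testInputs : length testInputs ≡ N + N
  length-testInputs = trans (List.length-++ (replicate N edgeless))
    (cong₂ _+_ (List.length-replicate N) (trans (List.length-map singleEdge (kSubsets n k)) (length-kSubsets n k)))

  correctOn-split : ∀ A → correctOn testInputs A ≡
    count (λ G → correct? G A) (replicate N edgeless) + count (λ e → correct? (singleEdge e) A) (kSubsets n k)
  correctOn-split A = trans (count-++ correct (replicate N edgeless) (map singleEdge (kSubsets n k)))
      (cong (λ m → count correct (replicate N edgeless) + m) (count-map correct singleEdge (kSubsets n k)))
    where
    correct = λ (G : Hypergraph n k) → correct? G A

  correctOn-≤-rejecting : ∀ A → run (A n k) (cIND edgeless) ≢ 1 →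
    correctOn testInputs A ≤ N + count (found? (A n k)) (kSubsets n k)
  correctOn-≤-rejecting A r≢1 = subst (_≤ N + count (found? (A n k)) (kSubsets n k))
    (sym (correctOn-split A)) (ℕ.+-mono-≤
    (ℕ.≤-trans (List.length-filter (λ G → correct? G A) (replicate N edgeless))
               (ℕ.≤-reflexive (List.length-replicate N)))
    (count-mono (λ e → correct? (singleEdge e) A) (found? (A n k))
      (λ e iff → Equivalence.from iff (s≤s z≤n)) (kSubsets n k)))

  correctOn-≤-accepting : ∀ A → run (A n k) (cIND edgeless) ≡ 1 → correctOn testInputs A ≤ N
  correctOn-≤-accepting A r≡1 = subst (_≤ N) (sym (trans (correctOn-split A) (cong (λ m → m + rest) wrong)))
      (ℕ.≤-trans (List.length-filter (λ e → correct? (singleEdge e) A) (kSubsets n k))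
                 (ℕ.≤-reflexive (length-kSubsets n k)))
    where
    rest = count (λ e → correct? (singleEdge e) A) (kSubsets n k)
    wrong : count (λ G → correct? G A) (replicate N edgeless) ≡ 0
    wrong = cong length (List.filter-none (λ G → correct? G A)
      (All.replicate⁺ N λ iff → contradiction (Equivalence.to iff r≡1) λ ()))

module _ (n k : ℕ) .{{_ : NonZero n}} .{{_ : NonZero k}} (α : ℝ) (α≤k : α ≤ᴿ fromℕ k) where

  private
    R = n ^ᴿ α
    N = n choose k

  -- If a query of size s is rainbow for c of the N possible edges, then c ≤ C(s,k), and
  -- so it costs at least n^α c/N.
  rainbow-bound : ∀ s → s ≤ n → ∀ c → c ≤ (s choose k) → R *ᴿ fromℕ c ≤ᴿ fromℕ N *ᴿ cost α s
  rainbow-bound zero      _   c c≤ = begin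
      R *ᴿ fromℕ c  ≈⟨ (λ i → cong (λ c → seq R i ℚ.* ι c) (ℕ.n≤0⇒n≡0 (ℕ.≤-trans c≤ (ℕ.≤-reflexive (0Ck k))))) ⟩
      R *ᴿ 0ᴿ       ≈⟨ (λ i → trans (ℚ.*-zeroʳ (seq R i)) (sym (ℚ.*-zeroʳ (ι N)))) ⟩
      fromℕ N *ᴿ 0ᴿ ∎
    where
    open ≤ᴿ-Reasoning
    0Ck : ∀ k .{{_ : NonZero k}} → 0 choose k ≡ 0
    0Ck (suc k) = refl
  rainbow-bound s@(suc _) s≤n c c≤ = pow-ratio n s s≤n {c} {N} k
    (ℕ.≤-trans (ℕ.*-monoˡ-≤ (n ^ k) c≤) (binomial-ratio k s≤n)) α α≤k

  -- A tree that does not report an edge on the edgeless hypergraph can report the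
  -- single edge e only if some query on its path for the edgeless hypergraph, where
  -- every answer is true, is rainbow for e.
  found-≤-cost : ∀ t → run t (cIND edgeless) ≢ 1 →
    R *ᴿ fromℕ (count (found? n k t) (kSubsets n k)) ≤ᴿ fromℕ N *ᴿ oracleCost α t (cIND edgeless)
  found-≤-cost (output r) r≢1 = begin
      R *ᴿ fromℕ (count (found? n k (output r)) (kSubsets n k))
        ≈⟨ (λ i → cong (λ c → seq R i ℚ.* ι c) (count-none (found? n k (output r)) (λ _ → r≢1) (kSubsets n k))) ⟩
      R *ᴿ 0ᴿ       ≈⟨ (λ i → trans (ℚ.*-zeroʳ (seq R i)) (sym (ℚ.*-zeroʳ (ι N)))) ⟩
      fromℕ N *ᴿ 0ᴿ ∎
    where open ≤ᴿ-Reasoning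
  found-≤-cost (query q t) r≢1 = begin
      R *ᴿ fromℕ (count (found? n k (query q t)) E)
        ≲⟨ *ᴿ-monoˡ-≤ {fromℕ (count (found? n k (query q t)) E)} {fromℕ (a + b)} R (^ᴿ≥0 n α)
             (fromℕ-mono-≤ (count-∪ (found? n k (query q t)) (λ (e , _) → rainbow? q e)
               (found? n k (t true)) split E)) ⟩
      R *ᴿ fromℕ (a + b)
        ≈⟨ (λ i → trans (cong (seq R i ℚ.*_) (ι-+ a b)) (ℚ.*-distribˡ-+ (seq R i) (ι a) (ι b))) ⟩
      R *ᴿ fromℕ a +ᴿ R *ᴿ fromℕ b
        ≲⟨ +ᴿ-mono-≤ {R *ᴿ fromℕ a} {fromℕ N *ᴿ cost α (querySize q)} {R *ᴿ fromℕ b} {fromℕ N *ᴿ rest}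
             (rainbow-bound (querySize q) (querySize≤n q) a (count-rainbow q))
             (found-≤-cost (t true) r≢1) ⟩
      fromℕ N *ᴿ cost α (querySize q) +ᴿ fromℕ N *ᴿ rest
        ≈⟨ (λ i → sym (ℚ.*-distribˡ-+ (ι N) (seq (cost α (querySize q)) i) (seq rest i))) ⟩
      fromℕ N *ᴿ (cost α (querySize q) +ᴿ rest) ∎
    where
    open ≤ᴿ-Reasoning
    E = kSubsets n k
    a = count (λ (e , _) → rainbow? q e) E
    b = count (found? n k (t true)) E
    rest = oracleCost α (t true) (cIND edgeless)
    split : ∀ e → run (query q t) (cIND (singleEdge e)) ≡ 1 →
      Rainbow q (proj₁ e) ⊎ run (t true) (cIND (singleEdge e)) ≡ 1
    split e h = decide (rainbow? q (proj₁ e))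
      where
      decide : Dec (Rainbow q (proj₁ e)) → Rainbow q (proj₁ e) ⊎ run (t true) (cIND (singleEdge e)) ≡ 1
      decide (yes r) = inj₁ r
      decide (no ¬r) = inj₂ (subst (λ b → run (t b) (cIND (singleEdge e)) ≡ 1) (cIND-singleEdge q e ¬r) h)

  -- An algorithm that is wrong on the edgeless hypergraph is correct on at most N test
  -- inputs. Any other algorithm is correct on N of them, and on those whose single edge
  -- it finds, which its cost on the edgeless hypergraph pays for.
  correctOn-≤ : ∀ A → R *ᴿ fromℕ (correctOn (testInputs n k) A) ≤ᴿ
    fromℕ N *ᴿ (R +ᴿ oracleCost α (A n k) (cIND edgeless))
  correctOn-≤ A = decide (run (A n k) (cIND edgeless) ℕ.≟ 1)
    where
    open ≤ᴿ-Reasoning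
    open ℝSolver using (_:+_; _:*_; _:=_; con)
    c = oracleCost α (A n k) (cIND edgeless)
    f = count (found? n k (A n k)) (kSubsets n k)
    decide : Dec (run (A n k) (cIND edgeless) ≡ 1) →
      R *ᴿ fromℕ (correctOn (testInputs n k) A) ≤ᴿ fromℕ N *ᴿ (R +ᴿ c)
    decide (yes r≡1) = begin
      R *ᴿ fromℕ (correctOn (testInputs n k) A)
        ≲⟨ *ᴿ-monoˡ-≤ {fromℕ (correctOn (testInputs n k) A)} {fromℕ N} R (^ᴿ≥0 n α)
             (fromℕ-mono-≤ (correctOn-≤-accepting n k A r≡1)) ⟩
      R *ᴿ fromℕ N
        ≈⟨ ℝSolver.solve 2 (λ R N → R :* N := N :* (R :+ con 0)) (λ _ → refl) R (fromℕ N) ⟩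
      fromℕ N *ᴿ (R +ᴿ 0ᴿ)
        ≲⟨ *ᴿ-monoˡ-≤ {R +ᴿ 0ᴿ} {R +ᴿ c} (fromℕ N) (fromℕ≥0 N)
             (+ᴿ-mono-≤ {R} {R} {0ᴿ} {c} (≤ᴿ-refl {R}) (oracleCost≥0 α (A n k) (cIND edgeless))) ⟩
      fromℕ N *ᴿ (R +ᴿ c) ∎
    decide (no r≢1) = begin
      R *ᴿ fromℕ (correctOn (testInputs n k) A)
        ≲⟨ *ᴿ-monoˡ-≤ {fromℕ (correctOn (testInputs n k) A)} {fromℕ (N + f)} R (^ᴿ≥0 n α)
             (fromℕ-mono-≤ (correctOn-≤-rejecting n k A r≢1)) ⟩
      R *ᴿ fromℕ (N + f)
        ≈⟨ (λ i → trans (cong (seq R i ℚ.*_) (ι-+ N f)) (ℚ.*-distribˡ-+ (seq R i) (ι N) (ι f))) ⟩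
      R *ᴿ fromℕ N +ᴿ R *ᴿ fromℕ f
        ≲⟨ +ᴿ-mono-≤ {R *ᴿ fromℕ N} {R *ᴿ fromℕ N} {R *ᴿ fromℕ f} {fromℕ N *ᴿ c} (≤ᴿ-refl {R *ᴿ fromℕ N})
             (found-≤-cost (A n k) r≢1) ⟩
      R *ᴿ fromℕ N +ᴿ fromℕ N *ᴿ c
        ≈⟨ ℝSolver.solve 3 (λ R N c → R :* N :+ N :* c := N :* (R :+ c)) (λ _ → refl) R (fromℕ N) c ⟩
      fromℕ N *ᴿ (R +ᴿ c) ∎

  weighted-correct-≤ : ∀ (𝒜 : RandAlg) (C : ℝ) → ExpectedCostAtMost α 𝒜 (edgeless {n} {k}) C → ∀ M →
    R *ᴿ partialSum (λ j → prob 𝒜 j *ᴿ fromℕ (correctOn (testInputs n k) (alg 𝒜 j))) M ≤ᴿ fromℕ N *ᴿ (R +ᴿ C)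
  weighted-correct-≤ 𝒜 C cheap M =
    average-≤ R N C (prob 𝒜) (λ j → fromℕ (correctOn (testInputs n k) (alg 𝒜 j)))
      (λ j → oracleCost α (alg 𝒜 j n k) (cIND edgeless)) M
      (^ᴿ≥0 n α) (prob≥0 𝒜) (λ j → correctOn-≤ (alg 𝒜 j)) (total≤1 𝒜 M) (cheap M)

------------------------------------------------------------------------
-- Randomised algorithms

-- If Z is at least 8/10 of 2N, then R Z ≤ N (R + C) gives 16/10 R ≤ R + C.
majority-bound : ∀ (R C Z : ℝ) N .{{_ : NonZero N}} → 0ᴿ ≤ᴿ R → fromℚ (+ 8 / 10) *ᴿ fromℕ (N + N) ≤ᴿ Z →
  R *ᴿ Z ≤ᴿ fromℕ N *ᴿ (R +ᴿ C) → R *ᴿ fromℚ (+ 6 / 10) ≤ᴿ C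
majority-bound R C Z N 0≤R h₁ h₂ =
    +ᴿ-cancelˡ-≤ {R *ᴿ fromℚ (+ 6 / 10)} {C} R
      (fromℕ-cancelˡ-≤ {R +ᴿ R *ᴿ fromℚ (+ 6 / 10)} {R +ᴿ C} N (begin
        fromℕ N *ᴿ (R +ᴿ R *ᴿ fromℚ (+ 6 / 10))    ≈⟨ (λ i → regroup (seq R i)) ⟩
        R *ᴿ (fromℚ (+ 8 / 10) *ᴿ fromℕ (N + N))
          ≲⟨ *ᴿ-monoˡ-≤ {fromℚ (+ 8 / 10) *ᴿ fromℕ (N + N)} {Z} R 0≤R h₁ ⟩
        R *ᴿ Z                                     ≲⟨ h₂ ⟩
        fromℕ N *ᴿ (R +ᴿ C) ∎))
  where
  open ≤ᴿ-Reasoning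
  regroup : ∀ r → ι N ℚ.* (r ℚ.+ r ℚ.* (+ 6 / 10)) ≡ r ℚ.* ((+ 8 / 10) ℚ.* ι (N + N))
  regroup r = trans
    (solve 2 (λ N r → N :* (r :+ r :* con (+ 6 / 10)) := r :* (con (+ 8 / 10) :* (N :+ N))) refl (ι N) r)
    (cong (λ m → r ℚ.* ((+ 8 / 10) ℚ.* m)) (sym (ι-+ N N)))
    where open ℚSolver.+-*-Solver

weighted-correct-≥ : ∀ (𝒜 : RandAlg) →
  (∀ (G : Hypergraph n k) → PrAtLeast 𝒜 (correct? G) (fromℚ (+ 9 / 10))) → ∀ 𝒢 →
  ∃[ M ] fromℚ (+ 8 / 10) *ᴿ fromℕ (length 𝒢) ≤ᴿ
    partialSum (λ j → prob 𝒜 j *ᴿ fromℕ (correctOn {n} {k} 𝒢 (alg 𝒜 j))) M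
weighted-correct-≥ 𝒜 reliable 𝒢 = likely-count (λ G j → correct? G (alg 𝒜 j)) (prob 𝒜) (prob≥0 𝒜)
  reliable 𝒢 (λ j → correctOn 𝒢 (alg 𝒜 j)) (λ _ → refl)

corollary66 : ∀ (n k : ℕ) → .{{_ : NonZero k}} → k ≤ n →
    ∀ (α : ℝ) → 0ᴿ ≤ᴿ α → α ≤ᴿ fromℕ k →
    ∀ (𝒜 : RandAlg) (C : ℝ) →
    WorstCaseExpectedCostAtMost n k α 𝒜 C →
    (∀ (G : Hypergraph n k) → PrAtLeast 𝒜 (correct? G) (fromℚ (+ 9 / 10))) →
    (n ^ᴿ α) *ᴿ fromℚ (+ 1 / 100) ≤ᴿ C
corollary66 n@(suc _) k@(suc _) k≤n α _ α≤k 𝒜 C cheap reliable = begin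
    n ^ᴿ α *ᴿ fromℚ (+ 1 / 100)
      ≲⟨ *ᴿ-monoˡ-≤ {fromℚ (+ 1 / 100)} {fromℚ (+ 6 / 10)} (n ^ᴿ α) (^ᴿ≥0 n α)
           (fromℚ-mono-≤ (toWitness {a? = + 1 / 100 ℚ.≤? + 6 / 10} _)) ⟩
    n ^ᴿ α *ᴿ fromℚ (+ 6 / 10)
      ≲⟨ majority-bound (n ^ᴿ α) C Z (n choose k) {{>-nonZero (nCk>0 k≤n)}} (^ᴿ≥0 n α) Z-large
           (weighted-correct-≤ n k α α≤k 𝒜 C (cheap edgeless) M) ⟩
    C ∎
  where
  open ≤ᴿ-Reasoning
  M = proj₁ (weighted-correct-≥ 𝒜 reliable (testInputs n k))
  Z = partialSum (λ j → prob 𝒜 j *ᴿ fromℕ (correctOn (testInputs n k) (alg 𝒜 j))) M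
  Z-large : fromℚ (+ 8 / 10) *ᴿ fromℕ ((n choose k) + (n choose k)) ≤ᴿ Z
  Z-large = subst (λ m → fromℚ (+ 8 / 10) *ᴿ fromℕ m ≤ᴿ Z) (length-testInputs n k)
    (proj₂ (weighted-correct-≥ 𝒜 reliable (testInputs n k)))
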